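{- Let $t$ be a first-order term. The refinement relation $\sqsubseteq$ is a finite distributive lattice on the multipatterns denoting $t$, with least element $\bot$ the empty let-expression $\mathsf{let}\ =\ \mathsf{in}\ t$ (no bindings, body $t$), and greatest element $\top$ of shape $\mathsf{let}\ X=t'\ \mathsf{in}\ X(\vec x)$ with $\vec x$ the vector of variables in $t$.
   Context: **Terms.** Fix a signature of function symbols and 2nd-order variables $X,Y,Z,\dots$, each having a natural number as arity, and 1st-order variables $x,y,z,\dots$. Terms are built from all of these; a 1st-order term contains no 2nd-order variables. **Multipatterns.** A multipattern is a let-expression $\mathsf{let}\ X_1,\dots,X_n=\lambda\vec x_1.s_1,\dots,\lambda\vec x_n.s_n\ \mathsf{in}\ M$ ($n\ge 0$), where the $X_i$ are pairwise distinct 2nd-order variables; each $s_i$ is a non-variable 1st-order term with $\lambda\vec x_i.s_i$ closed and $\vec x_i$ of length the arity of $X_i$; $M$ (the body) is a term with 2nd-order variables among $X_1,\dots,X_n$; and the let-expression is linear (each $X_i$ occurs exactly once in $M$, each variable of $\vec x_i$ occurs exactly once in $s_i$) and canonical (the $X_i$ are listed in the order in which they occur in the pre-order walk of $M$, and likewise the $\vec x_i$ in $s_i$). The prefixes $\lambda\vec x_i$ are usually omitted. $M$ may contain (possibly repeated) free 1st-order variables. Multipatterns are identified up to renaming of let- and $\lambda$-bound variables. The multipattern denotes the 1st-order term $[\![\mathsf{let}\ \vec X=\vec s\ \mathsf{in}\ M]\!]$ obtained from $M$ by 2nd-order substitution of $\lambda\vec x_i.s_i$ for $X_i$, for all $i$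 (this definition of denotation also makes sense for let-expressions that are not linear). In $\top$, since a multipattern is linear, $t'$ is a linear term, and variables repeated in $t$ are repeated in the vector $\vec x$, so that $[\![\top]\!]=t$. **Refinement.** For multipatterns $\varsigma=\mathsf{let}\ \vec X=\vec s\ \mathsf{in}\ M$ and $\zeta=\mathsf{let}\ \vec Y=\vec u\ \mathsf{in}\ N$, $\varsigma\sqsubseteq\zeta$ ($\varsigma$ refines $\zeta$) if there is a 2nd-order substitution $\sigma$ on $\vec Y$ with $N^\sigma=M$ and $[\![\mathsf{let}\ \vec X=\vec s\ \mathsf{in}\ (Y_i(\vec y_i))^\sigma]\!]=u_i$ for all $i$, where $\vec y_i$ are the ($\lambda$-bound) variables of $u_i$.
   Formalization: The stated shape of the greatest element is claimed only when t is not a variable: for t a variable no multipattern has that shape, as let-bound terms must be non-variable; a greatest element is still asserted for every t. -}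

module Defs where

open import Data.Fin using (Fin; zero; suc; _≤_; _≟_)
open import Data.List using (List; []; _∷_; _++_; [_]; filter; length)
open import Data.List.Relation.Unary.AllPairs using (AllPairs)
open import Data.Nat using (ℕ)
open import Data.Product using (Σ-syntax; ∃-syntax; _×_)
open import Data.Vec as Vec using (Vec; []; _∷_; lookup; tabulate; fromList)
open import Data.Vec.Relation.Unary.All using (All; []; _∷_)
open import Data.Vec.Relation.Unary.All.Properties using (lookup⁺)
open import Function.Bundles using (Inverse)
open import Level using (0ℓ)
open import Relation.Binary.Bundles using (Setoid)
open import Relation.Binary.PropositionalEquality as ≡ using (_≡_)
open import Relation.Nullary using (¬_)
import Relation.Binary.Construct.On as On

record Signature : Set₁ where
  field
    Symbol   : Set
    arity    : Symbol → ℕ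
    Variable : Set

Finite : Setoid 0ℓ 0ℓ → Set
Finite A = ∃[ n ] Inverse A (≡.setoid (Fin n))

OccursOnceIn : ∀ {n} → Fin n → List (Fin n) → Set
OccursOnceIn i is = length (filter (i ≟_) is) ≡ 1

InOrder : ∀ {n} → List (Fin n) → Set
InOrder = AllPairs _≤_

module Multipatterns (S : Signature) where
  open Signature S

  -- Let- and λ-bound variables are nameless, so that terms equal up to renaming
  -- of bound variables are propositionally equal.  In Term Θ k, the 2nd-order
  -- variables are the positions of Θ, which lists their arities; of the
  -- 1st-order variables, `free x` is named, and `bound j` is the j-th variable
  -- of an enclosing prefix λ x₁ … x_k.  A λ-abstraction of arity k is thus
  -- given by its matrix in Term Θ k.
  data Term {n : ℕ} (Θ : Vec ℕ n) (k : ℕ) : Set where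
    free  : Variable → Term Θ k
    bound : Fin k → Term Θ k
    fun   : (f : Symbol) → Vec (Term Θ k) (arity f) → Term Θ k
    app   : (X : Fin n) → Vec (Term Θ k) (lookup Θ X) → Term Θ k

  Term₁ : ℕ → Set
  Term₁ = Term []

  data IsVariable {n : ℕ} {Θ : Vec ℕ n} {k : ℕ} : Term Θ k → Set where
    free  : ∀ x → IsVariable (free x)
    bound : ∀ j → IsVariable (bound j)

  module _ {n : ℕ} {Θ : Vec ℕ n} {k : ℕ} where

    -- Occurrences, with repetitions, in the order of the pre-order walk.

    vars₂  : Term Θ k → List (Fin n)
    vars₂* : ∀ {m} → Vec (Term Θ k) m → List (Fin n)
    vars₂ (free x)   = []
    vars₂ (bound j)  = []
    vars₂ (fun f ts) = vars₂* ts
    vars₂ (app X ts) = X ∷ vars₂* ts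
    vars₂* []        = []
    vars₂* (t ∷ ts)  = vars₂ t ++ vars₂* ts

    frees  : Term Θ k → List Variable
    frees* : ∀ {m} → Vec (Term Θ k) m → List Variable
    frees (free x)   = [ x ]
    frees (bound j)  = []
    frees (fun f ts) = frees* ts
    frees (app X ts) = frees* ts
    frees* []        = []
    frees* (t ∷ ts)  = frees t ++ frees* ts

    bounds  : Term Θ k → List (Fin k)
    bounds* : ∀ {m} → Vec (Term Θ k) m → List (Fin k)
    bounds (free x)   = []
    bounds (bound j)  = [ j ]
    bounds (fun f ts) = bounds* ts
    bounds (app X ts) = bounds* ts
    bounds* []        = []
    bounds* (t ∷ ts)  = bounds t ++ bounds* ts

    -- β-reduct of (λ x₁ … x_k . t) us
    infixl 8 _⟨_⟩ _⟨_⟩*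
    _⟨_⟩  : ∀ {l} → Term Θ k → Vec (Term Θ l) k → Term Θ l
    _⟨_⟩* : ∀ {l m} → Vec (Term Θ k) m → Vec (Term Θ l) k → Vec (Term Θ l) m
    free x   ⟨ us ⟩ = free x
    bound j  ⟨ us ⟩ = lookup us j
    fun f ts ⟨ us ⟩ = fun f (ts ⟨ us ⟩*)
    app X ts ⟨ us ⟩ = app X (ts ⟨ us ⟩*)
    []       ⟨ us ⟩* = []
    (t ∷ ts) ⟨ us ⟩* = t ⟨ us ⟩ ∷ ts ⟨ us ⟩*

  Subst₂ : ∀ {m n} → Vec ℕ m → Vec ℕ n → Set
  Subst₂ Δ Θ = ∀ Y → Term Θ (lookup Δ Y)

  module _ {m n : ℕ} {Δ : Vec ℕ m} {Θ : Vec ℕ n} {k : ℕ} where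

    infixl 8 _^_ _^*_
    _^_  : Term Δ k → Subst₂ Δ Θ → Term Θ k
    _^*_ : ∀ {l} → Vec (Term Δ k) l → Subst₂ Δ Θ → Vec (Term Θ k) l
    free x   ^ σ = free x
    bound j  ^ σ = bound j
    fun f ts ^ σ = fun f (ts ^* σ)
    app Y ts ^ σ = σ Y ⟨ ts ^* σ ⟩
    []       ^* σ = []
    (t ∷ ts) ^* σ = t ^ σ ∷ ts ^* σ

  -- The body of a let-expression may use k variables bound outside of it, as is
  -- needed for refinement; multipatterns have k = 0.
  record Let (k : ℕ) : Set where
    constructor let[_]_within_
    field
      {size}   : ℕ
      arities  : Vec ℕ size
      bindings : All Term₁ arities
      body     : Term arities k

    binding : (X : Fin size) → Term₁ (lookup arities X)
    binding = lookup⁺ bindings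

  ⟦_⟧ : ∀ {k} → Let k → Term₁ k
  ⟦ L ⟧ = Let.body L ^ Let.binding L

  record IsMultipattern (L : Let 0) : Set where
    open Let L
    field
      binding-nonVariable : ∀ X → ¬ IsVariable (binding X)
      binding-closed      : ∀ X → frees (binding X) ≡ []
      body-linear         : ∀ X → OccursOnceIn X (vars₂ body)
      binding-linear      : ∀ X j → OccursOnceIn j (bounds (binding X))
      body-canonical      : InOrder (vars₂ body)
      binding-canonical   : ∀ X → InOrder (bounds (binding X))

  infix 4 _⊑_
  _⊑_ : Let 0 → Let 0 → Set
  ς ⊑ ζ = Σ[ σ ∈ Subst₂ ζ.arities ς.arities ]
      ζ.body ^ σ ≡ ς.body
    × (∀ Y → ⟦ let[ ς.arities ] ς.bindings within (Y⟨y⃗⟩ Y ^ σ) ⟧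
             ≡ ζ.binding Y)
    where
    module ς = Let ς
    module ζ = Let ζ
    Y⟨y⃗⟩ : ∀ Y → Term ζ.arities (lookup ζ.arities Y)
    Y⟨y⃗⟩ Y = app Y (tabulate bound)

  record MultipatternDenoting (t : Term₁ 0) : Set where
    field
      expr           : Let 0
      isMultipattern : IsMultipattern expr
      denotes        : ⟦ expr ⟧ ≡ t

  open MultipatternDenoting public using (expr)

  multipatternsDenoting : Term₁ 0 → Setoid 0ℓ 0ℓ
  multipatternsDenoting t =
    On.setoid (≡.setoid (Let 0)) (expr {t})

  emptyLet : Term₁ 0 → Let 0
  emptyLet t = let[ [] ] [] within t

  -- let X = t′ in X(x⃗), where x⃗ lists the variable occurrences in t
  singleLet : (t : Term₁ 0) → Term₁ (length (frees t)) → Let 0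
  singleLet t t′ =
    let[ length (frees t) ∷ [] ] (t′ ∷ []) within
      app zero (Vec.map free (fromList (frees t)))

-- Label every function symbol of t as lying outside all let-bound patterns, as the root of one, or
-- as an inner symbol, i.e. one that belongs to the same pattern as its parent.  Linearity and
-- canonicity leave no further choice, so the multipatterns denoting t correspond to the labellings
-- in which no inner symbol is at the root of t or directly below an outside symbol.  Refinement
-- becomes the pointwise order for outside < root < inner, and these labellings are closed under
-- pointwise minimum and maximum: they form a sublattice of a finite power of a chain.
module Submission where

open import Algebra.Core using (Op₂)
open import Data.Fin as Fin using (Fin; zero; suc; _↑ˡ_; _↑ʳ_)
open import Data.List as List
  using (List; []; _∷_; _++_; length; concat; concatMap; filter; allFin)
open import Data.List.Membership.Propositional using (_∈_)
open import Data.List.Membership.Propositional.Properties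
  using (∈-cartesianProductWith⁺; ∈-lookup)
open import Data.List.Membership.Setoid.Properties using (∈-deduplicate⁺)
open import Data.List.Properties
  using (map-++; map-∘; map-tabulate; concatMap-++; ∷-injective; ∷-injectiveˡ; ∷-injectiveʳ;
         length-tabulate; length-++; length-map;
         ++-assoc; ++-identityʳ; ++-conicalˡ; ++-conicalʳ)
open import Data.List.Relation.Unary.All as All using (All; []; _∷_)
open import Data.List.Relation.Unary.All.Properties as All using (++⁻ˡ; ++⁻ʳ)
open import Data.List.Relation.Unary.AllPairs as AllPairs using (AllPairs; []; _∷_)
import Data.List.Relation.Unary.AllPairs.Properties as AllPairs
open import Data.List.Relation.Unary.Any as Any using (Any; here; there)
import Data.List.Relation.Unary.Any.Properties as Any
open import Data.List.Relation.Unary.Unique.DecSetoid.Properties using (deduplicate-!)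
open import Data.Nat using (ℕ; zero; suc; _+_; s≤s)
import Data.Nat.Properties as ℕ
open import Data.Product using (Σ-syntax; ∃-syntax; _×_; _,_; proj₁; proj₂)
open import Data.Vec as Vec using (Vec; []; _∷_; lookup)
open import Data.Vec.Properties
  using (lookup-++ˡ; lookup-++ʳ; lookup∘tabulate; toList-++; toList-map; toList∘fromList)
open import Data.Vec.Relation.Unary.All using ([]; _∷_) renaming (All to VAll)
open import Data.Vec.Relation.Unary.All.Properties using (lookup⁺)
open import Function.Base using (_∘_; id; _on_)
open import Level using (0ℓ)
open import Relation.Binary.Bundles using (Setoid; DecSetoid)
open import Relation.Binary.Definitions using (Minimum; Maximum; Decidable)
open import Relation.Binary.Lattice.Structures using (IsDistributiveLattice)
open import Relation.Binary.PropositionalEquality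
  using (_≡_; refl; sym; trans; cong; cong₂; subst; subst₂)
open import Relation.Nullary using (¬_; yes; no; contradiction)
open import Relation.Nullary.Decidable using (map′; _×-dec_)
open import Defs

-- Why refinement is the pointwise order: a substitution witnessing refinement sends each let-bound
-- variable of the coarser multipattern to a piece of the finer body that denotes its pattern.
-- Symbols outside the coarser patterns stay outside. The root symbol of a coarser pattern comes
-- from the top of such a piece, which is either a function symbol of the finer body or the top of a
-- finer binding; a binding is never a variable, so that symbol becomes outside or root, never
-- inner. The inner symbols of a coarser pattern are unrestricted. Conversely, cutting the finer
-- body along the coarser patterns yields the pieces. What shapes the constructions is that a term
-- is traversed in two modes. Not below a pattern symbol, a subterm yields one term; below one, it
-- yields the vector of subterms filling the holes of that pattern. Hence the pairs `body` and
-- `args`, `skeleton` and `skeletons`, `mark` and `plug`, and the vector splittings throughout.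

-- Lists, positions and finite setoids

tabulate-+ : ∀ {a} {A : Set a} m {n} (f : Fin (m + n) → A) →
  List.tabulate f ≡ List.tabulate (f ∘ (_↑ˡ n)) ++ List.tabulate (f ∘ (m ↑ʳ_))
tabulate-+ zero    f = refl
tabulate-+ (suc m) f = cong (f zero ∷_) (tabulate-+ m (f ∘ suc))

++-splitˡ : ∀ {a} {A : Set a} (as cs : List A) {bs ds} →
  length as ≡ length cs → as ++ bs ≡ cs ++ ds → as ≡ cs
++-splitˡ []       []       _ _ = refl
++-splitˡ (a ∷ as) (c ∷ cs) h e with refl , e′ ← ∷-injective e =
  cong (a ∷_) (++-splitˡ as cs (ℕ.suc-injective h) e′)

++-splitʳ : ∀ {a} {A : Set a} (as cs : List A) {bs ds} →
  length as ≡ length cs → as ++ bs ≡ cs ++ ds → bs ≡ ds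
++-splitʳ []       []       _ e = e
++-splitʳ (a ∷ as) (c ∷ cs) h e = ++-splitʳ as cs (ℕ.suc-injective h) (∷-injectiveʳ e)

module _ {a b} {A : Set a} {B : Set b} (f : A → B) {m n} (xs : Vec A m) (ys : Vec A n)
  {g : Fin (m + n) → B} where
  lookup-++-splitˡ : (∀ i → g i ≡ f (lookup (xs Vec.++ ys) i)) → ∀ i → g (i ↑ˡ n) ≡ f (lookup xs i)
  lookup-++-splitˡ e i = trans (e (i ↑ˡ n)) (cong f (lookup-++ˡ xs ys i))

  lookup-++-splitʳ : (∀ i → g i ≡ f (lookup (xs Vec.++ ys) i)) → ∀ i → g (m ↑ʳ i) ≡ f (lookup ys i)
  lookup-++-splitʳ e i = trans (e (m ↑ʳ i)) (cong f (lookup-++ʳ xs ys i))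

count : ∀ {n : ℕ} → Fin n → List (Fin n) → ℕ
count i is = length (filter (i Fin.≟_) is)

count-map-suc : ∀ {n} (i : Fin n) is → count (suc i) (List.map suc is) ≡ count i is
count-map-suc i [] = refl
count-map-suc i (j ∷ is) with i Fin.≟ j
... | yes _ = cong suc (count-map-suc i is)
... | no  _ = count-map-suc i is

count-zero-map-suc : ∀ {n} (is : List (Fin n)) → count zero (List.map suc is) ≡ 0
count-zero-map-suc []       = refl
count-zero-map-suc (_ ∷ is) = count-zero-map-suc is

allFin-suc : ∀ n → allFin (suc n) ≡ zero ∷ List.map suc (allFin n)
allFin-suc n = cong (zero ∷_) (sym (map-tabulate id suc))

allFin-once : ∀ {n} (i : Fin n) → OccursOnceIn i (allFin n)
allFin-once {suc n} zero    =
  trans (cong (count zero) (allFin-suc n)) (cong suc (count-zero-map-suc (allFin n)))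
allFin-once {suc n} (suc i) =
  trans (cong (count (suc i)) (allFin-suc n)) (trans (count-map-suc i (allFin n)) (allFin-once i))

allFin-inOrder : ∀ n → InOrder (allFin n)
allFin-inOrder n = AllPairs.tabulate⁺-< (λ i<j → ℕ.<⇒≤ i<j)

count-zero⇒map-suc : ∀ {n} (is : List (Fin (suc n))) → count zero is ≡ 0 →
  ∃[ js ] is ≡ List.map suc js
count-zero⇒map-suc []          _ = [] , refl
count-zero⇒map-suc (suc i ∷ is) c with js , refl ← count-zero⇒map-suc is c = i ∷ js , refl

inOrder-map-suc⁻ : ∀ {n} (is : List (Fin n)) → InOrder (List.map suc is) → InOrder is
inOrder-map-suc⁻ is = AllPairs.map (λ { (s≤s i≤j) → i≤j }) ∘ AllPairs.map⁻

all-suc⇒count-zero : ∀ {n} (i : Fin n) {is : List (Fin (suc n))} → All (suc i Fin.≤_) is →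
  count zero is ≡ 0
all-suc⇒count-zero i [] = refl
all-suc⇒count-zero i {suc _ ∷ _} (_ ∷ ps) = all-suc⇒count-zero i ps

-- An ordered list that starts with a successor contains no `zero`, so the head is `zero`; as this
-- is its only occurrence, the tail is a list of successors and the induction applies. This is how
-- linearity and canonicity fix the numbering of bound variables.
inOrder-once⇒allFin : ∀ {n} (is : List (Fin n)) → InOrder is → (∀ i → OccursOnceIn i is) →
  is ≡ allFin n
inOrder-once⇒allFin {zero}  []       _ _ = refl
inOrder-once⇒allFin {suc n} []       _ o = contradiction (o zero) λ ()
inOrder-once⇒allFin {suc n} (suc i ∷ is) (ps ∷ _) o =
  contradiction (trans (sym (o zero)) (all-suc⇒count-zero i ps)) λ ()
inOrder-once⇒allFin {suc n} (zero ∷ is) (_ ∷ ps) o with js , refl ← count-zero⇒map-suc is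
  (ℕ.suc-injective (o zero)) =
  trans (cong (λ js → zero ∷ List.map suc js)
           (inOrder-once⇒allFin js (inOrder-map-suc⁻ js ps)
              (λ i → trans (sym (count-map-suc i js)) (o (suc i)))))
        (sym (allFin-suc n))

toList-injective : ∀ {a} {A : Set a} {n} (xs ys : Vec A n) → Vec.toList xs ≡ Vec.toList ys → xs ≡ ys
toList-injective []       []       _ = refl
toList-injective (x ∷ xs) (y ∷ ys) e =
  cong₂ _∷_ (∷-injectiveˡ e) (toList-injective xs ys (∷-injectiveʳ e))

map-lookup-allFin : ∀ {a} {A : Set a} {n} (xs : Vec A n) →
  List.map (lookup xs) (allFin n) ≡ Vec.toList xs
map-lookup-allFin []       = refl
map-lookup-allFin (x ∷ xs) = cong (x ∷_)
  (trans (trans (map-tabulate suc _) (sym (map-tabulate id _))) (map-lookup-allFin xs))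

concatMap-lookup-allFin : ∀ {a b} {A : Set a} {B : Set b} (f : A → List B) {n} (xs : Vec A n) →
  concatMap (f ∘ lookup xs) (allFin n) ≡ concatMap f (Vec.toList xs)
concatMap-lookup-allFin f xs =
  cong concat (trans (map-∘ (allFin _)) (cong (List.map f) (map-lookup-allFin xs)))

tabulate-subst : ∀ {h k} (e : h ≡ k) → List.tabulate (subst Fin e) ≡ allFin k
tabulate-subst refl = refl

-- Reads an association list as a dependent function: its keys come in the order of `f`, so the i-th
-- entry is the value at `i`. It will assemble a 2nd-order substitution from images collected along
-- a term.
tabulate-keys : ∀ {p} {m} {A : Set} {P : A → Set p} {f : Fin m → A} (es : List (Σ[ x ∈ A ] P x)) →
  List.map proj₁ es ≡ List.tabulate f →
    Σ[ g ∈ (∀ i → P (f i)) ] es ≡ List.tabulate (λ i → f i , g i)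
tabulate-keys {m = zero}  []             _ = (λ ()) , refl
tabulate-keys {m = suc _} ((x , p) ∷ es) e with refl ← ∷-injectiveˡ e | g , refl ← tabulate-keys es
  (∷-injectiveʳ e) =
  (λ { zero → p ; (suc i) → g i }) , refl

module _ (A : DecSetoid 0ℓ 0ℓ) where
  open DecSetoid A renaming (refl to ≈-refl; sym to ≈-sym; trans to ≈-trans)

  lookup-unique : ∀ {xs} → AllPairs (λ x y → ¬ x ≈ y) xs → ∀ i j →
    List.lookup xs i ≈ List.lookup xs j → i ≡ j
  lookup-unique (_ ∷ _)  zero    zero    _ = refl
  lookup-unique (n ∷ _)  zero    (suc j) e = contradiction e (All.lookup n (∈-lookup j))
  lookup-unique (n ∷ _)  (suc i) zero    e = contradiction (≈-sym e) (All.lookup n (∈-lookup i))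
  lookup-unique (_ ∷ us) (suc i) (suc j) e = cong suc (lookup-unique us i j e)

  -- After deduplication no two entries are equivalent, so the position of an element is determined
  -- by its class and is inverse to `lookup`.
  enumerable⇒finite : ∀ xs → (∀ x → Any (x ≈_) xs) → Finite setoid
  enumerable⇒finite xs enum = length ys , record
    { to        = pos
    ; from      = List.lookup ys
    ; to-cong   =
      λ {x} {y} x≈y → lookup-unique unique _ _ (≈-trans (≈-sym (at-pos x)) (≈-trans x≈y (at-pos y)))
    ; from-cong = λ { refl → ≈-refl }
    ; inverse   = (λ {i} x≈yᵢ → lookup-unique unique _ i (≈-trans (≈-sym (at-pos _)) x≈yᵢ))
                , (λ { {x} refl → ≈-sym (at-pos x) })
    }
    where
    ys = List.deduplicate _≟_ xs
    unique = deduplicate-! A xs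
    member : ∀ x → Any (x ≈_) ys
    member x = ∈-deduplicate⁺ setoid _≟_ (λ y≈z x≈y → ≈-trans x≈y (≈-sym y≈z)) (enum x)
    pos : Carrier → Fin (length ys)
    pos x = Any.index (member x)
    at-pos : ∀ x → x ≈ List.lookup ys (pos x)
    at-pos x = Any.lookup-index (member x)

-- The chain of labels

data Label : Set where
  outside root inner : Label

infix 4 _≤ˡ_
data _≤ˡ_ : Label → Label → Set where
  outside≤ : ∀ {a} → outside ≤ˡ a
  ≤inner   : ∀ {a} → a ≤ˡ inner
  root≤root : root ≤ˡ root

≤ˡ-refl : ∀ {a} → a ≤ˡ a
≤ˡ-refl {outside} = outside≤
≤ˡ-refl {root}    = root≤root
≤ˡ-refl {inner}   = ≤inner

≤ˡ-trans : ∀ {a b c} → a ≤ˡ b → b ≤ˡ c → a ≤ˡ c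
≤ˡ-trans outside≤  _         = outside≤
≤ˡ-trans ≤inner    ≤inner    = ≤inner
≤ˡ-trans root≤root q         = q

≤ˡ-antisym : ∀ {a b} → a ≤ˡ b → b ≤ˡ a → a ≡ b
≤ˡ-antisym outside≤  outside≤  = refl
≤ˡ-antisym ≤inner    ≤inner    = refl
≤ˡ-antisym root≤root _         = refl

infix 4 _≟ˡ_
_≟ˡ_ : Decidable {A = Label} _≡_
outside ≟ˡ outside = yes refl
outside ≟ˡ root    = no λ ()
outside ≟ˡ inner   = no λ ()
root    ≟ˡ outside = no λ ()
root    ≟ˡ root    = yes refl
root    ≟ˡ inner   = no λ ()
inner   ≟ˡ outside = no λ ()
inner   ≟ˡ root    = no λ ()
inner   ≟ˡ inner   = yes refl

infixr 7 _∧ˡ_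
infixr 6 _∨ˡ_
_∧ˡ_ _∨ˡ_ : Op₂ Label
outside ∧ˡ b       = outside
root    ∧ˡ outside = outside
root    ∧ˡ root    = root
root    ∧ˡ inner   = root
inner   ∧ˡ b       = b
outside ∨ˡ b       = b
root    ∨ˡ outside = root
root    ∨ˡ root    = root
root    ∨ˡ inner   = inner
inner   ∨ˡ b       = inner

∧ˡ-lowerˡ : ∀ a b → a ∧ˡ b ≤ˡ a
∧ˡ-lowerˡ outside b       = outside≤
∧ˡ-lowerˡ root    outside = outside≤
∧ˡ-lowerˡ root    root    = root≤root
∧ˡ-lowerˡ root    inner   = root≤root
∧ˡ-lowerˡ inner   b       = ≤inner

∧ˡ-lowerʳ : ∀ a b → a ∧ˡ b ≤ˡ b
∧ˡ-lowerʳ outside b       = outside≤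
∧ˡ-lowerʳ root    outside = outside≤
∧ˡ-lowerʳ root    root    = root≤root
∧ˡ-lowerʳ root    inner   = ≤inner
∧ˡ-lowerʳ inner   b       = ≤ˡ-refl

∧ˡ-greatest : ∀ {a b c} → a ≤ˡ b → a ≤ˡ c → a ≤ˡ b ∧ˡ c
∧ˡ-greatest outside≤  _         = outside≤
∧ˡ-greatest ≤inner    q         = q
∧ˡ-greatest root≤root ≤inner    = root≤root
∧ˡ-greatest root≤root root≤root = root≤root

∨ˡ-upperˡ : ∀ a b → a ≤ˡ a ∨ˡ b
∨ˡ-upperˡ outside b       = outside≤
∨ˡ-upperˡ root    outside = root≤root
∨ˡ-upperˡ root    root    = root≤root
∨ˡ-upperˡ root    inner   = ≤inner
∨ˡ-upperˡ inner   b       = ≤inner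

∨ˡ-upperʳ : ∀ a b → b ≤ˡ a ∨ˡ b
∨ˡ-upperʳ outside b       = ≤ˡ-refl
∨ˡ-upperʳ root    outside = outside≤
∨ˡ-upperʳ root    root    = root≤root
∨ˡ-upperʳ root    inner   = ≤inner
∨ˡ-upperʳ inner   b       = ≤inner

∨ˡ-least : ∀ {a b c} → a ≤ˡ c → b ≤ˡ c → a ∨ˡ b ≤ˡ c
∨ˡ-least outside≤  q         = q
∨ˡ-least ≤inner    q         = ≤inner
∨ˡ-least root≤root outside≤  = root≤root
∨ˡ-least root≤root root≤root = root≤root

∧ˡ-distribˡ-∨ˡ : ∀ a b c → a ∧ˡ (b ∨ˡ c) ≡ (a ∧ˡ b) ∨ˡ (a ∧ˡ c)
∧ˡ-distribˡ-∨ˡ outside b       c       = refl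
∧ˡ-distribˡ-∨ˡ root    outside c       = refl
∧ˡ-distribˡ-∨ˡ root    root    outside = refl
∧ˡ-distribˡ-∨ˡ root    root    root    = refl
∧ˡ-distribˡ-∨ˡ root    root    inner   = refl
∧ˡ-distribˡ-∨ˡ root    inner   outside = refl
∧ˡ-distribˡ-∨ˡ root    inner   root    = refl
∧ˡ-distribˡ-∨ˡ root    inner   inner   = refl
∧ˡ-distribˡ-∨ˡ inner   b       c       = refl

module Labellings (S : Signature) where
  open Signature S
  open Multipatterns S

  -- From labellings to multipatterns

  -- Variables carry no label: bindings are closed, so an occurrence of a variable in the denoted
  -- term always comes from the body.
  data Lab : Term₁ 0 → Set where
    free : ∀ {x} → Lab (free x)
    fun  : ∀ {f ts} → Label → VAll Lab ts → Lab (fun f ts)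

  Pattern : Set
  Pattern = Σ[ k ∈ ℕ ] Term₁ k

  -- `holes`, `ctx` and `args` regard a labelling as the part of t just below a symbol of a pattern:
  -- the inner symbols at its top continue the pattern, and each maximal labelled subterm whose root
  -- is not inner fills a hole.  The renaming r numbers the holes.
  holes  : ∀ {t} → Lab t → ℕ
  holes* : ∀ {m} {ts : Vec _ m} → VAll Lab ts → ℕ
  holes free            = 1
  holes (fun outside _) = 1
  holes (fun root _)    = 1
  holes (fun inner ls)  = holes* ls
  holes* []       = 0
  holes* (l ∷ ls) = holes l + holes* ls

  ctx  : ∀ {k t} (l : Lab t) → (Fin (holes l) → Fin k) → Term₁ k
  ctx* : ∀ {k m} {ts : Vec _ m} (ls : VAll Lab ts) → (Fin (holes* ls) → Fin k) → Vec (Term₁ k) m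
  ctx free               r = bound (r zero)
  ctx (fun outside _)    r = bound (r zero)
  ctx (fun root _)       r = bound (r zero)
  ctx (fun {f} inner ls) r = fun f (ctx* ls r)
  ctx* []       r = []
  ctx* (l ∷ ls) r = ctx l (r ∘ (_↑ˡ holes* ls)) ∷ ctx* ls (r ∘ (holes l ↑ʳ_))

  -- Listed in pre-order, the order that canonicity prescribes for let-bound variables.
  patterns  : ∀ {t} → Lab t → List Pattern
  patterns* : ∀ {m} {ts : Vec _ m} → VAll Lab ts → List Pattern
  patterns free              = []
  patterns (fun outside ls)  = patterns* ls
  patterns (fun {f} root ls) = (holes* ls , fun f (ctx* ls id)) ∷ patterns* ls
  patterns (fun inner ls)    = patterns* ls
  patterns* []       = []
  patterns* (l ∷ ls) = patterns l ++ patterns* ls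

  -- A pointer to a binding, indexed by the pattern found there, so that `apply` needs no transport
  -- along an equality of arities. The constructions below take a list of pointers: a subterm gets
  -- the slice for its own patterns, while `Θ` remains that of the whole let-expression.
  data At {n} {Θ : Vec ℕ n} (bs : VAll Term₁ Θ) : Pattern → Set where
    at : ∀ X → At bs (lookup Θ X , lookup⁺ bs X)

  module _ {n} {Θ : Vec ℕ n} {bs : VAll Term₁ Θ} where
    index : ∀ {p} → At bs p → Fin n
    index (at X) = X

    indices : ∀ {ps} → All (At bs) ps → List (Fin n)
    indices = All.reduce index

    apply : ∀ {p k} → At bs p → Vec (Term Θ k) (proj₁ p) → Term Θ k
    apply (at X) ts = app X ts

    body  : ∀ {t} (l : Lab t) → All (At bs) (patterns l) → Term Θ 0
    args  : ∀ {t} (l : Lab t) → All (At bs) (patterns l) → Vec (Term Θ 0) (holes l)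
    body* : ∀ {m} {ts : Vec _ m} (ls : VAll Lab ts) → All (At bs) (patterns* ls) → Vec (Term Θ 0) m
    args* : ∀ {m} {ts : Vec _ m} (ls : VAll Lab ts) → All (At bs) (patterns* ls) →
      Vec (Term Θ 0) (holes* ls)
    body (free {x})           ρ       = free x
    body (fun {f} outside ls) ρ       = fun f (body* ls ρ)
    body (fun root ls)        (p ∷ ρ) = apply p (args* ls ρ)
    -- junk: an inner symbol is met here only if its parent is not in a pattern
    body (fun {f} inner ls)   ρ       = fun f (body* ls ρ)
    args l@free             ρ = body l ρ ∷ []
    args l@(fun outside _)  ρ = body l ρ ∷ []
    args l@(fun root _)     ρ = body l ρ ∷ []
    args (fun inner ls)     ρ = args* ls ρ
    body* []       ρ = []
    body* (l ∷ ls) ρ = body l (++⁻ˡ (patterns l) ρ) ∷ body* ls (++⁻ʳ (patterns l) ρ)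
    args* []       ρ = []
    args* (l ∷ ls) ρ = args l (++⁻ˡ (patterns l) ρ) Vec.++ args* ls (++⁻ʳ (patterns l) ρ)

    lookup-^* : ∀ {k m} (ts : Vec (Term Θ k) m) i →
      lookup (ts ^* lookup⁺ bs) i ≡ lookup ts i ^ lookup⁺ bs
    lookup-^* (t ∷ ts) zero    = refl
    lookup-^* (t ∷ ts) (suc i) = lookup-^* ts i

    apply-^ : ∀ {p k} (a : At bs p) (ts : Vec (Term Θ k) (proj₁ p)) →
      apply a ts ^ lookup⁺ bs ≡ proj₂ p ⟨ ts ^* lookup⁺ bs ⟩
    apply-^ (at X) ts = refl

    body-^  : ∀ {t} (l : Lab t) ρ → body l ρ ^ lookup⁺ bs ≡ t
    body*-^ : ∀ {m} {ts : Vec _ m} (ls : VAll Lab ts) ρ → body* ls ρ ^* lookup⁺ bs ≡ ts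
    -- The hypothesis compares `us` with the arguments through `r`, because the recursion restricts
    -- `r` to the holes of one subterm and keeps `us` whole.
    ctx-⟨⟩  : ∀ {k t} (l : Lab t) ρ (r : Fin (holes l) → Fin k) us →
      (∀ i → lookup us (r i) ≡ lookup (args l ρ) i ^ lookup⁺ bs) → ctx l r ⟨ us ⟩ ≡ t
    ctx*-⟨⟩ : ∀ {k m} {ts : Vec _ m} (ls : VAll Lab ts) ρ (r : Fin (holes* ls) → Fin k) us →
      (∀ i → lookup us (r i) ≡ lookup (args* ls ρ) i ^ lookup⁺ bs) → ctx* ls r ⟨ us ⟩* ≡ ts
    body-^ free                ρ       = refl
    body-^ (fun outside ls)    ρ       = cong (fun _) (body*-^ ls ρ)
    body-^ (fun {f} root ls)   (p ∷ ρ) = trans (apply-^ p (args* ls ρ))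
      (cong (fun f) (ctx*-⟨⟩ ls ρ id _ (lookup-^* (args* ls ρ))))
    body-^ (fun inner ls)      ρ       = cong (fun _) (body*-^ ls ρ)
    body*-^ []       ρ = refl
    body*-^ (l ∷ ls) ρ = cong₂ _∷_ (body-^ l _) (body*-^ ls _)
    ctx-⟨⟩ l@free            ρ r us H = trans (H zero) (body-^ l ρ)
    ctx-⟨⟩ l@(fun outside _) ρ r us H = trans (H zero) (body-^ l ρ)
    ctx-⟨⟩ l@(fun root _)    ρ r us H = trans (H zero) (body-^ l ρ)
    ctx-⟨⟩ (fun inner ls)    ρ r us H = cong (fun _) (ctx*-⟨⟩ ls ρ r us H)
    ctx*-⟨⟩ []       ρ r us H = refl
    ctx*-⟨⟩ (l ∷ ls) ρ r us H = cong₂ _∷_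
      (ctx-⟨⟩ l _ _ us (lookup-++-splitˡ (_^ lookup⁺ bs) (args l _) (args* ls _) H))
      (ctx*-⟨⟩ ls _ _ us (lookup-++-splitʳ (_^ lookup⁺ bs) (args l _) (args* ls _) H))

    indices-++ : ∀ ps {qs} (ρ : All (At bs) (ps ++ qs)) →
      indices ρ ≡ indices (++⁻ˡ ps ρ) ++ indices (++⁻ʳ ps ρ)
    indices-++ []       ρ       = refl
    indices-++ (_ ∷ ps) (x ∷ ρ) = cong (index x ∷_) (indices-++ ps ρ)

    length-indices : ∀ {ps} (ρ : All (At bs) ps) → length (indices ρ) ≡ length ps
    length-indices []      = refl
    length-indices (_ ∷ ρ) = cong suc (length-indices ρ)

    vars₂-apply : ∀ {p k} (a : At bs p) (ts : Vec (Term Θ k) (proj₁ p)) →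
      vars₂ (apply a ts) ≡ index a ∷ vars₂* ts
    vars₂-apply (at X) ts = refl

    vars₂*-++ : ∀ {k m n} (ts : Vec (Term Θ k) m) (us : Vec (Term Θ k) n) →
      vars₂* (ts Vec.++ us) ≡ vars₂* ts ++ vars₂* us
    vars₂*-++ []       us = refl
    vars₂*-++ (t ∷ ts) us =
      trans (cong (vars₂ t ++_) (vars₂*-++ ts us)) (sym (++-assoc (vars₂ t) _ _))

    vars₂-body  : ∀ {t} (l : Lab t) ρ → vars₂ (body l ρ) ≡ indices ρ
    vars₂-args  : ∀ {t} (l : Lab t) ρ → vars₂* (args l ρ) ≡ indices ρ
    vars₂-body* : ∀ {m} {ts : Vec _ m} (ls : VAll Lab ts) ρ → vars₂* (body* ls ρ) ≡ indices ρ
    vars₂-args* : ∀ {m} {ts : Vec _ m} (ls : VAll Lab ts) ρ → vars₂* (args* ls ρ) ≡ indices ρ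
    vars₂-body free             []      = refl
    vars₂-body (fun outside ls) ρ       = vars₂-body* ls ρ
    vars₂-body (fun root ls)    (p ∷ ρ) =
      trans (vars₂-apply p (args* ls ρ)) (cong (index p ∷_) (vars₂-args* ls ρ))
    vars₂-body (fun inner ls)   ρ       = vars₂-body* ls ρ
    vars₂-args l@free            ρ = trans (++-identityʳ _) (vars₂-body l ρ)
    vars₂-args l@(fun outside _) ρ = trans (++-identityʳ _) (vars₂-body l ρ)
    vars₂-args l@(fun root _)    ρ = trans (++-identityʳ _) (vars₂-body l ρ)
    vars₂-args (fun inner ls)    ρ = vars₂-args* ls ρ
    vars₂-body* []       [] = refl
    vars₂-body* (l ∷ ls) ρ =
      trans (cong₂ _++_ (vars₂-body l _) (vars₂-body* ls _)) (sym (indices-++ (patterns l) ρ))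
    vars₂-args* []       [] = refl
    vars₂-args* (l ∷ ls) ρ = trans (vars₂*-++ (args l _) _)
      (trans (cong₂ _++_ (vars₂-args l _) (vars₂-args* ls _)) (sym (indices-++ (patterns l) ρ)))

  -- Holes are numbered from left to right. For `r = id` the right-hand side is `allFin`, which
  -- gives linearity and canonicity of the binding together.
  bounds-ctx  : ∀ {k t} (l : Lab t) (r : Fin (holes l) → Fin k) → bounds (ctx l r) ≡ List.tabulate r
  bounds-ctx* : ∀ {k m} {ts : Vec _ m} (ls : VAll Lab ts) (r : Fin (holes* ls) → Fin k) →
    bounds* (ctx* ls r) ≡ List.tabulate r
  bounds-ctx free            r = refl
  bounds-ctx (fun outside _) r = refl
  bounds-ctx (fun root _)    r = refl
  bounds-ctx (fun inner ls)  r = bounds-ctx* ls r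
  bounds-ctx* []       r = refl
  bounds-ctx* (l ∷ ls) r =
    trans (cong₂ _++_ (bounds-ctx l _) (bounds-ctx* ls _)) (sym (tabulate-+ (holes l) r))

  frees-ctx  : ∀ {k t} (l : Lab t) (r : Fin (holes l) → Fin k) → frees (ctx l r) ≡ []
  frees-ctx* : ∀ {k m} {ts : Vec _ m} (ls : VAll Lab ts) (r : Fin (holes* ls) → Fin k) →
    frees* (ctx* ls r) ≡ []
  frees-ctx free            r = refl
  frees-ctx (fun outside _) r = refl
  frees-ctx (fun root _)    r = refl
  frees-ctx (fun inner ls)  r = frees-ctx* ls r
  frees-ctx* []       r = refl
  frees-ctx* (l ∷ ls) r rewrite frees-ctx l (r ∘ (_↑ˡ holes* ls)) = frees-ctx* ls _

  -- `bounds-all` condenses linearity and canonicity of a binding, by `inOrder-once⇒allFin`.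
  record IsPattern (p : Pattern) : Set where
    constructor isPattern
    field
      nonVariable : ¬ IsVariable (proj₂ p)
      closed      : frees (proj₂ p) ≡ []
      bounds-all  : bounds (proj₂ p) ≡ allFin (proj₁ p)

  patterns-isPattern  : ∀ {t} (l : Lab t) → All IsPattern (patterns l)
  patterns*-isPattern : ∀ {m} {ts : Vec _ m} (ls : VAll Lab ts) → All IsPattern (patterns* ls)
  patterns-isPattern free             = []
  patterns-isPattern (fun outside ls) = patterns*-isPattern ls
  patterns-isPattern (fun root ls)    =
    isPattern (λ ()) (frees-ctx* ls id) (bounds-ctx* ls id) ∷ patterns*-isPattern ls
  patterns-isPattern (fun inner ls)   = patterns*-isPattern ls
  patterns*-isPattern []       = []
  patterns*-isPattern (l ∷ ls) = All.++⁺ (patterns-isPattern l) (patterns*-isPattern ls)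

  Context : Set
  Context = Σ[ n ∈ ℕ ] Σ[ Θ ∈ Vec ℕ n ] VAll Term₁ Θ

  patternArities : (ps : List Pattern) → Vec ℕ (length ps)
  patternArities []             = []
  patternArities ((k , _) ∷ ps) = k ∷ patternArities ps

  patternBindings : (ps : List Pattern) → VAll Term₁ (patternArities ps)
  patternBindings []             = []
  patternBindings ((_ , s) ∷ ps) = s ∷ patternBindings ps

  shift : ∀ {p ps q} → At (patternBindings ps) q → At (patternBindings (p ∷ ps)) q
  shift (at X) = at (suc X)

  pointers : ∀ ps → All (At (patternBindings ps)) ps
  pointers []       = []
  pointers (p ∷ ps) = at zero ∷ All.map shift (pointers ps)

  indices-map-suc : ∀ p ps {qs} (ρ : All (At (patternBindings ps)) qs) →
    indices {bs = patternBindings (p ∷ ps)} (All.map shift ρ) ≡ List.map suc (indices ρ)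
  indices-map-suc p ps []         = refl
  indices-map-suc p ps (at X ∷ ρ) = cong (suc X ∷_) (indices-map-suc p ps ρ)

  indices-pointers : ∀ ps → indices (pointers ps) ≡ allFin (length ps)
  indices-pointers []       = refl
  indices-pointers (p ∷ ps) = trans (cong (zero ∷_) (trans (indices-map-suc p ps (pointers ps))
     (cong (List.map suc) (indices-pointers ps)))) (sym (allFin-suc (length ps)))

  patternBindings-isPattern : ∀ {ps} → All IsPattern ps → ∀ X →
    IsPattern (lookup (patternArities ps) X , lookup⁺ (patternBindings ps) X)
  patternBindings-isPattern (p ∷ ps) zero    = p
  patternBindings-isPattern (p ∷ ps) (suc X) = patternBindings-isPattern ps X

  toLet : ∀ {t} → Lab t → Let 0
  toLet l = let[ patternArities ps ] patternBindings ps within body l (pointers ps)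
    where ps = patterns l

  vars₂-toLet : ∀ {t} (l : Lab t) → vars₂ (Let.body (toLet l)) ≡ allFin (length (patterns l))
  vars₂-toLet l = trans (vars₂-body l (pointers (patterns l))) (indices-pointers (patterns l))

  toLet-isMultipattern : ∀ {t} (l : Lab t) → IsMultipattern (toLet l)
  toLet-isMultipattern l = record
    { binding-nonVariable = λ X → IsPattern.nonVariable (pat X)
    ; binding-closed      = λ X → IsPattern.closed (pat X)
    ; body-linear         = λ X → subst (OccursOnceIn X) (sym (vars₂-toLet l)) (allFin-once X)
    ; binding-linear      =
      λ X j → subst (OccursOnceIn j) (sym (IsPattern.bounds-all (pat X))) (allFin-once j)
    ; body-canonical      = subst InOrder (sym (vars₂-toLet l)) (allFin-inOrder _)
    ; binding-canonical   =
      λ X → subst InOrder (sym (IsPattern.bounds-all (pat X))) (allFin-inOrder _)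
    }
    where pat = patternBindings-isPattern (patterns-isPattern l)

  toMultipattern : ∀ {t} → Lab t → MultipatternDenoting t
  toMultipattern l =
    record { expr = toLet l ; isMultipattern = toLet-isMultipattern l ; denotes = body-^ l _ }

  -- t and t′ will be equal only propositionally; a heterogeneous relation saves transports.
  data Pointwise (R : Label → Label → Set) : ∀ {t t′} → Lab t → Lab t′ → Set
  data Pointwise* (R : Label → Label → Set) : ∀ {m} {ts ts′ : Vec (Term₁ 0) m} → VAll Lab ts →
    VAll Lab ts′ → Set
  data Pointwise R where
    free : ∀ {x} → Pointwise R (free {x}) (free {x})
    fun  : ∀ {f ts ts′ a a′} {ls : VAll Lab ts} {ls′ : VAll Lab ts′} →
           R a a′ → Pointwise* R ls ls′ → Pointwise R (fun {f} a ls) (fun {f} a′ ls′)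
  data Pointwise* R where
    []  : Pointwise* R [] []
    _∷_ : ∀ {t t′ m} {l : Lab t} {l′ : Lab t′} {ts ts′ : Vec _ m} {ls : VAll Lab ts}
      {ls′ : VAll Lab ts′} →
          Pointwise R l l′ → Pointwise* R ls ls′ → Pointwise* R (l ∷ ls) (l′ ∷ ls′)

  infix 4 _≤_ _≅_
  _≤_ _≅_ : ∀ {t t′} → Lab t → Lab t′ → Set
  _≤_ = Pointwise _≤ˡ_
  _≅_ = Pointwise _≡_

  -- From multipatterns to labellings

  -- Labels `s` as the continuation of a pattern already begun, whereas `mark` begins one; the two
  -- differ only at a topmost function symbol of `s`. The labels `os` belong to the subterms in the
  -- holes.
  plug  : ∀ {k} (s : Term₁ k) {us : Vec _ k} → VAll Lab us → Lab (s ⟨ us ⟩)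
  plug* : ∀ {k m} (ss : Vec (Term₁ k) m) {us : Vec _ k} → VAll Lab us → VAll Lab (ss ⟨ us ⟩*)
  plug (free x)   os = free
  plug (bound j)  os = lookup⁺ os j
  plug (fun f ss) os = fun inner (plug* ss os)
  plug* []       os = []
  plug* (s ∷ ss) os = plug s os ∷ plug* ss os

  mark : ∀ {k} (s : Term₁ k) {us : Vec _ k} → VAll Lab us → Lab (s ⟨ us ⟩)
  mark (free x)   os = free
  mark (bound j)  os = lookup⁺ os j
  mark (fun f ss) os = fun root (plug* ss os)

  module _ {n} {Θ : Vec ℕ n} (bs : VAll Term₁ Θ) where
    label  : (M : Term Θ 0) → Lab (M ^ lookup⁺ bs)
    label* : ∀ {m} (Ms : Vec (Term Θ 0) m) → VAll Lab (Ms ^* lookup⁺ bs)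
    label (free x)   = free
    label (fun f Ms) = fun outside (label* Ms)
    label (app X Ms) = mark (lookup⁺ bs X) (label* Ms)
    label* []       = []
    label* (M ∷ Ms) = label M ∷ label* Ms

  plug-⟨⟩  : ∀ {h k} (p : Term₁ h) (us : Vec (Term₁ k) h) {vs : Vec _ k} {ws : Vec _ h}
    (qs : VAll Lab ws) (os : VAll Lab vs) →
    (∀ j → lookup⁺ qs j ≤ plug (lookup us j) os) → plug p qs ≤ plug (p ⟨ us ⟩) os
  plug*-⟨⟩ : ∀ {h k m} (ps : Vec (Term₁ h) m) (us : Vec (Term₁ k) h) {vs : Vec _ k} {ws : Vec _ h}
    (qs : VAll Lab ws) (os : VAll Lab vs) →
    (∀ j → lookup⁺ qs j ≤ plug (lookup us j) os) →
      Pointwise* _≤ˡ_ (plug* ps qs) (plug* (ps ⟨ us ⟩*) os)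
  plug-⟨⟩ (free x)   us qs os H = free
  plug-⟨⟩ (bound j)  us qs os H = H j
  plug-⟨⟩ (fun f ps) us qs os H = fun ≤inner (plug*-⟨⟩ ps us qs os H)
  plug*-⟨⟩ []       us qs os H = []
  plug*-⟨⟩ (p ∷ ps) us qs os H = plug-⟨⟩ p us qs os H ∷ plug*-⟨⟩ ps us qs os H

  mark-⟨⟩ : ∀ {h k} (p : Term₁ h) (us : Vec (Term₁ k) h) {vs : Vec _ k} {ws : Vec _ h}
    (qs : VAll Lab ws) (os : VAll Lab vs) →
    (∀ j → lookup⁺ qs j ≤ plug (lookup us j) os) → mark p qs ≤ plug (p ⟨ us ⟩) os
  mark-⟨⟩ (free x)   us qs os H = free
  mark-⟨⟩ (bound j)  us qs os H = H j
  mark-⟨⟩ (fun f ps) us qs os H = fun ≤inner (plug*-⟨⟩ ps us qs os H)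

  module _ {n} {Θ : Vec ℕ n} (bs : VAll Term₁ Θ) where
    -- On the right every function symbol contributed by `s` is inner, the greatest label; only the
    -- holes remain, and they are covered by the hypothesis.
    label-⟨⟩  : ∀ {k} (s : Term Θ k) (Ms : Vec (Term Θ 0) k) {us : Vec _ k} (os : VAll Lab us) →
      (∀ j → label bs (lookup Ms j) ≤ lookup⁺ os j) → label bs (s ⟨ Ms ⟩) ≤ plug (s ^ lookup⁺ bs) os
    label*-⟨⟩ : ∀ {k m} (ss : Vec (Term Θ k) m) (Ms : Vec (Term Θ 0) k) {us : Vec _ k}
      (os : VAll Lab us) →
      (∀ j → label bs (lookup Ms j) ≤ lookup⁺ os j) →
        Pointwise* _≤ˡ_ (label* bs (ss ⟨ Ms ⟩*)) (plug* (ss ^* lookup⁺ bs) os)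
    lookup-label*-⟨⟩ : ∀ {k m} (ss : Vec (Term Θ k) m) (Ms : Vec (Term Θ 0) k) {us : Vec _ k}
      (os : VAll Lab us) →
      (∀ j → label bs (lookup Ms j) ≤ lookup⁺ os j) →
      ∀ i → lookup⁺ (label* bs (ss ⟨ Ms ⟩*)) i ≤ plug (lookup (ss ^* lookup⁺ bs) i) os
    label-⟨⟩ (free x)   Ms os H = free
    label-⟨⟩ (bound j)  Ms os H = H j
    label-⟨⟩ (fun f ss) Ms os H = fun outside≤ (label*-⟨⟩ ss Ms os H)
    label-⟨⟩ (app X ss) Ms os H =
      mark-⟨⟩ (lookup⁺ bs X) (ss ^* lookup⁺ bs) (label* bs (ss ⟨ Ms ⟩*)) os
      (lookup-label*-⟨⟩ ss Ms os H)
    label*-⟨⟩ []       Ms os H = []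
    label*-⟨⟩ (s ∷ ss) Ms os H = label-⟨⟩ s Ms os H ∷ label*-⟨⟩ ss Ms os H
    lookup-label*-⟨⟩ (s ∷ ss) Ms os H zero    = label-⟨⟩ s Ms os H
    lookup-label*-⟨⟩ (s ∷ ss) Ms os H (suc i) = lookup-label*-⟨⟩ ss Ms os H i

    NonVariables : Set
    NonVariables = ∀ X → ¬ IsVariable (lookup⁺ bs X)

    -- If `p` is not a variable, the topmost symbol belongs to `p` and is a root on both sides. For
    -- a bound variable it would come from `lookup us j`: a root on the right, but possibly inner on
    -- the left.
    mark-mark : ∀ {h k} (p : Term₁ h) (us : Vec (Term₁ k) h) {vs : Vec _ k} {ws : Vec _ h}
      (qs : VAll Lab ws) (os : VAll Lab vs) →
      ¬ IsVariable p → (∀ j → lookup⁺ qs j ≤ plug (lookup us j) os) → mark p qs ≤ mark (p ⟨ us ⟩) os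
    mark-mark (free x)   us qs os nv H = contradiction (free x) nv
    mark-mark (bound j)  us qs os nv H = contradiction (bound j) nv
    mark-mark (fun f ps) us qs os nv H = fun root≤root (plug*-⟨⟩ ps us qs os H)

    -- Here a root of the coarser labelling is compared with the finer one. At the top of the image
    -- `s` stands a function symbol, which is outside, or some `app X`, whose binding starts with a
    -- root.
    label-mark : NonVariables →
      ∀ {k} (s : Term Θ k) (Ms : Vec (Term Θ 0) k) {us : Vec _ k} (os : VAll Lab us) →
      ¬ IsVariable (s ^ lookup⁺ bs) →
      (∀ j → label bs (lookup Ms j) ≤ lookup⁺ os j) → label bs (s ⟨ Ms ⟩) ≤ mark (s ^ lookup⁺ bs) os
    label-mark nvs (free x)   Ms os nv H = contradiction (free x) nv
    label-mark nvs (bound j)  Ms os nv H = contradiction (bound j) nv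
    label-mark nvs (fun f ss) Ms os nv H = fun outside≤ (label*-⟨⟩ ss Ms os H)
    label-mark nvs (app X ss) Ms os nv H =
      mark-mark (lookup⁺ bs X) (ss ^* lookup⁺ bs) (label* bs (ss ⟨ Ms ⟩*)) os (nvs X)
      (lookup-label*-⟨⟩ ss Ms os H)

    module _ {m} {Δ : Vec ℕ m} (ds : VAll Term₁ Δ) (σ : Subst₂ Δ Θ) (nvs : NonVariables)
      (nvs′ : ∀ Y → ¬ IsVariable (lookup⁺ ds Y)) (eq : ∀ Y → σ Y ^ lookup⁺ bs ≡ lookup⁺ ds Y) where
      -- Refinement implies the pointwise order. Function symbols of `N` survive in `N ^ σ` and are
      -- outside on both sides; at a 2nd-order variable, `label-mark` compares its image with its
      -- pattern.
      label-^  : ∀ N → label bs (N ^ σ) ≤ label ds N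
      label*-^ : ∀ {m} (Ns : Vec _ m) → Pointwise* _≤ˡ_ (label* bs (Ns ^* σ)) (label* ds Ns)
      lookup-label*-^ : ∀ {m} (Ns : Vec _ m) j →
        label bs (lookup (Ns ^* σ) j) ≤ lookup⁺ (label* ds Ns) j
      label-^ (free x)   = free
      label-^ (fun f Ns) = fun outside≤ (label*-^ Ns)
      label-^ (app Y Ns) = subst (λ u → label bs (σ Y ⟨ Ns ^* σ ⟩) ≤ mark u (label* ds Ns)) (eq Y)
        (label-mark nvs (σ Y) (Ns ^* σ) (label* ds Ns)
          (subst (¬_ ∘ IsVariable) (sym (eq Y)) (nvs′ Y)) (lookup-label*-^ Ns))
      label*-^ []       = []
      label*-^ (N ∷ Ns) = label-^ N ∷ label*-^ Ns
      lookup-label*-^ (N ∷ Ns) zero    = label-^ N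
      lookup-label*-^ (N ∷ Ns) (suc j) = lookup-label*-^ Ns j

  ⟨bound⟩  : ∀ {n} {Θ : Vec ℕ n} {k} (s : Term Θ k) → s ⟨ Vec.tabulate bound ⟩ ≡ s
  ⟨bound⟩* : ∀ {n} {Θ : Vec ℕ n} {k m} (ss : Vec (Term Θ k) m) → ss ⟨ Vec.tabulate bound ⟩* ≡ ss
  ⟨bound⟩ (free x)   = refl
  ⟨bound⟩ (bound j)  = lookup∘tabulate bound j
  ⟨bound⟩ (fun f ss) = cong (fun f) (⟨bound⟩* ss)
  ⟨bound⟩ (app X ss) = cong (app X) (⟨bound⟩* ss)
  ⟨bound⟩* []       = refl
  ⟨bound⟩* (s ∷ ss) = cong₂ _∷_ (⟨bound⟩ s) (⟨bound⟩* ss)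

  module _ {m n} {Δ : Vec ℕ m} {Θ : Vec ℕ n} (σ : Subst₂ Δ Θ) where
    bounds-^ : ∀ {k l} (f : Fin l → Fin k) →
      Vec.tabulate {A = Term Δ k} (λ i → bound (f i)) ^* σ ≡ Vec.tabulate (λ i → bound (f i))
    bounds-^ {l = zero}  f = refl
    bounds-^ {l = suc l} f = cong (_ ∷_) (bounds-^ (f ∘ suc))

    -- Undoes the η-expansion in the definition of `_⊑_`, where the image of `Y` appears as the
    -- value of `σ` at `Y` applied to its own λ-bound variables.
    app-^ : ∀ Y → _^_ {Δ = Δ} (app Y (Vec.tabulate bound)) σ ≡ σ Y
    app-^ Y = trans (cong (σ Y ⟨_⟩) (bounds-^ id)) (⟨bound⟩ (σ Y))

  -- Refinement from the order of labellings

  data NonInner : ∀ {t} → Lab t → Set where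
    free    : ∀ {x} → NonInner (free {x})
    outside : ∀ {f ts} {ls : VAll Lab ts} → NonInner (fun {f} outside ls)
    root    : ∀ {f ts} {ls : VAll Lab ts} → NonInner (fun {f} root ls)

  module _ {n} {Θ : Vec ℕ n} {bs : VAll Term₁ Θ} where
    -- For l ≤ l′, each pattern of l′ covers a part of the body of l.  Below a symbol of the pattern,
    -- `skeleton` is the covered part of the body and `pieces` fills the holes of the pattern; as
    -- `args` for `body`, `skeletons` replaces `skeleton` where l itself continues a pattern.
    pieces  : ∀ {t t′} {l : Lab t} {l′ : Lab t′} → l ≤ l′ → All (At bs) (patterns l) →
      Vec (Term Θ 0) (holes l′)
    pieces* : ∀ {m} {ts ts′ : Vec _ m} {ls : VAll Lab ts} {ls′ : VAll Lab ts′} →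
      Pointwise* _≤ˡ_ ls ls′ →
      All (At bs) (patterns* ls) → Vec (Term Θ 0) (holes* ls′)
    pieces {l = l} {free}          d ρ = body l ρ ∷ []
    pieces {l = l} {fun outside _} d ρ = body l ρ ∷ []
    pieces {l = l} {fun root _}    d ρ = body l ρ ∷ []
    pieces {l = fun outside _} {fun inner _} (fun _ ds) ρ       = pieces* ds ρ
    -- The pointer of this root is dropped here: its variable belongs to the skeleton.
    pieces {l = fun root _}    {fun inner _} (fun _ ds) (_ ∷ ρ) = pieces* ds ρ
    pieces {l = fun inner _}   {fun inner _} (fun _ ds) ρ       = pieces* ds ρ
    pieces* [] ρ = []
    pieces* {ls = l ∷ _} (d ∷ ds) ρ =
      pieces d (++⁻ˡ (patterns l) ρ) Vec.++ pieces* ds (++⁻ʳ (patterns l) ρ)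

    skeleton  : ∀ {k t t′} {l : Lab t} {l′ : Lab t′} → l ≤ l′ → All (At bs) (patterns l) →
      (Fin (holes l′) → Fin k) → Term Θ k
    skeletons : ∀ {k t t′} {l : Lab t} {l′ : Lab t′} → l ≤ l′ → All (At bs) (patterns l) →
      (Fin (holes l′) → Fin k) → Vec (Term Θ k) (holes l)
    skeleton* : ∀ {k m} {ts ts′ : Vec _ m} {ls : VAll Lab ts} {ls′ : VAll Lab ts′} →
      Pointwise* _≤ˡ_ ls ls′ →
      All (At bs) (patterns* ls) → (Fin (holes* ls′) → Fin k) → Vec (Term Θ k) m
    skeletons* : ∀ {k m} {ts ts′ : Vec _ m} {ls : VAll Lab ts} {ls′ : VAll Lab ts′} →
      Pointwise* _≤ˡ_ ls ls′ →
      All (At bs) (patterns* ls) → (Fin (holes* ls′) → Fin k) → Vec (Term Θ k) (holes* ls)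
    skeleton {l′ = free}          d ρ r = bound (r zero)
    skeleton {l′ = fun outside _} d ρ r = bound (r zero)
    skeleton {l′ = fun root _}    d ρ r = bound (r zero)
    skeleton {l = fun outside _} {fun {f} inner _} (fun _ ds) ρ r       = fun f (skeleton* ds ρ r)
    skeleton {l = fun root _}    {fun {f} inner _} (fun _ ds) (p ∷ ρ) r =
      apply p (skeletons* ds ρ r)
    -- Junk, chosen to match the corresponding clause of `body`: an inner symbol of `l` is met here
    -- only if its parent is not in a pattern of `l`.
    skeleton {l = fun inner _}   {fun {f} inner _} (fun _ ds) ρ r       = fun f (skeleton* ds ρ r)
    skeletons {l = free}          d ρ r = skeleton d ρ r ∷ []
    skeletons {l = fun outside _} d ρ r = skeleton d ρ r ∷ []
    skeletons {l = fun root _}    d ρ r = skeleton d ρ r ∷ []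
    skeletons {l = fun inner _} {fun inner _} (fun _ ds) ρ r = skeletons* ds ρ r
    skeleton* [] ρ r = []
    skeleton* {ls = l ∷ _} {l′ ∷ ls′} (d ∷ ds) ρ r =
      skeleton d (++⁻ˡ (patterns l) ρ) (r ∘ (_↑ˡ holes* ls′))
      ∷ skeleton* ds (++⁻ʳ (patterns l) ρ) (r ∘ (holes l′ ↑ʳ_))
    skeletons* [] ρ r = []
    skeletons* {ls = l ∷ _} {l′ ∷ ls′} (d ∷ ds) ρ r =
      skeletons d (++⁻ˡ (patterns l) ρ) (r ∘ (_↑ˡ holes* ls′))
      Vec.++ skeletons* ds (++⁻ʳ (patterns l) ρ) (r ∘ (holes l′ ↑ʳ_))

    apply-⟨⟩ : ∀ {p k k′} (a : At bs p) (ts : Vec (Term Θ k) (proj₁ p)) (us : Vec (Term Θ k′) k) →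
      apply a ts ⟨ us ⟩ ≡ apply a (ts ⟨ us ⟩*)
    apply-⟨⟩ (at X) ts us = refl

    ++-⟨⟩* : ∀ {k k′ m m′} (ts : Vec (Term Θ k) m) (ts′ : Vec (Term Θ k) m′)
      (us : Vec (Term Θ k′) k) →
      (ts Vec.++ ts′) ⟨ us ⟩* ≡ ts ⟨ us ⟩* Vec.++ ts′ ⟨ us ⟩*
    ++-⟨⟩* []       ts′ us = refl
    ++-⟨⟩* (t ∷ ts) ts′ us = cong (_ ∷_) (++-⟨⟩* ts ts′ us)

    module _ {k} (us : Vec (Term Θ 0) k) where
      -- First of the two equations that refinement asks of an image: with its holes filled by the
      -- pieces, the skeleton is the covered part of the finer body.
      skeleton-⟨⟩  : ∀ {t t′} {l : Lab t} {l′ : Lab t′} (d : l ≤ l′) ρ r →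
        (∀ i → lookup us (r i) ≡ lookup (pieces d ρ) i) → skeleton d ρ r ⟨ us ⟩ ≡ body l ρ
      skeletons-⟨⟩ : ∀ {t t′} {l : Lab t} {l′ : Lab t′} (d : l ≤ l′) ρ r →
        (∀ i → lookup us (r i) ≡ lookup (pieces d ρ) i) → skeletons d ρ r ⟨ us ⟩* ≡ args l ρ
      skeleton*-⟨⟩ : ∀ {m} {ts ts′ : Vec _ m} {ls : VAll Lab ts} {ls′ : VAll Lab ts′}
        (ds : Pointwise* _≤ˡ_ ls ls′) ρ r →
        (∀ i → lookup us (r i) ≡ lookup (pieces* ds ρ) i) →
          skeleton* ds ρ r ⟨ us ⟩* ≡ body* ls ρ
      skeletons*-⟨⟩ : ∀ {m} {ts ts′ : Vec _ m} {ls : VAll Lab ts} {ls′ : VAll Lab ts′}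
        (ds : Pointwise* _≤ˡ_ ls ls′) ρ r →
        (∀ i → lookup us (r i) ≡ lookup (pieces* ds ρ) i) →
          skeletons* ds ρ r ⟨ us ⟩* ≡ args* ls ρ
      skeleton-⟨⟩ {l′ = free}          d ρ r H = H zero
      skeleton-⟨⟩ {l′ = fun outside _} d ρ r H = H zero
      skeleton-⟨⟩ {l′ = fun root _}    d ρ r H = H zero
      skeleton-⟨⟩ {l = fun outside _} {fun {f} inner _} (fun _ ds) ρ r H       =
        cong (fun f) (skeleton*-⟨⟩ ds ρ r H)
      skeleton-⟨⟩ {l = fun root _}    {fun {f} inner _} (fun _ ds) (p ∷ ρ) r H =
        trans (apply-⟨⟩ p (skeletons* ds ρ r) us) (cong (apply p) (skeletons*-⟨⟩ ds ρ r H))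
      skeleton-⟨⟩ {l = fun inner _}   {fun {f} inner _} (fun _ ds) ρ r H       =
        cong (fun f) (skeleton*-⟨⟩ ds ρ r H)
      skeletons-⟨⟩ {l = free}          d ρ r H = cong (_∷ []) (skeleton-⟨⟩ d ρ r H)
      skeletons-⟨⟩ {l = fun outside _} d ρ r H = cong (_∷ []) (skeleton-⟨⟩ d ρ r H)
      skeletons-⟨⟩ {l = fun root _}    d ρ r H = cong (_∷ []) (skeleton-⟨⟩ d ρ r H)
      skeletons-⟨⟩ {l = fun inner _} {fun inner _} (fun _ ds) ρ r H = skeletons*-⟨⟩ ds ρ r H
      skeleton*-⟨⟩ [] ρ r H = refl
      skeleton*-⟨⟩ (d ∷ ds) ρ r H = cong₂ _∷_
        (skeleton-⟨⟩ d _ _ (lookup-++-splitˡ id (pieces d _) (pieces* ds _) H))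
        (skeleton*-⟨⟩ ds _ _ (lookup-++-splitʳ id (pieces d _) (pieces* ds _) H))
      skeletons*-⟨⟩ [] ρ r H = refl
      skeletons*-⟨⟩ (d ∷ ds) ρ r H =
        trans (++-⟨⟩* (skeletons d _ _) (skeletons* ds _ _) us) (cong₂ Vec._++_
        (skeletons-⟨⟩ d _ _ (lookup-++-splitˡ id (pieces d _) (pieces* ds _) H))
        (skeletons*-⟨⟩ ds _ _ (lookup-++-splitʳ id (pieces d _) (pieces* ds _) H)))

    -- Second equation asked of an image: the skeleton denotes the coarser pattern. In
    -- `skeletons-^`, a finer pattern `ctx l q` has its holes filled by denotations of skeletons and
    -- thus grows into the coarser one.
    skeleton-^  : ∀ {k t t′} {l : Lab t} {l′ : Lab t′} (d : l ≤ l′) ρ (r : _ → Fin k) →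
      skeleton d ρ r ^ lookup⁺ bs ≡ ctx l′ r
    skeletons-^ : ∀ {k k′ t t′} {l : Lab t} {l′ : Lab t′} (d : l ≤ l′) ρ (r : _ → Fin k)
      (q : _ → Fin k′) us →
      (∀ i → lookup us (q i) ≡ lookup (skeletons d ρ r) i ^ lookup⁺ bs) → ctx l q ⟨ us ⟩ ≡ ctx l′ r
    skeleton*-^  : ∀ {k m} {ts ts′ : Vec _ m} {ls : VAll Lab ts} {ls′ : VAll Lab ts′}
      (ds : Pointwise* _≤ˡ_ ls ls′) ρ (r : _ → Fin k) → skeleton* ds ρ r ^* lookup⁺ bs ≡ ctx* ls′ r
    skeletons*-^ : ∀ {k k′ m} {ts ts′ : Vec _ m} {ls : VAll Lab ts} {ls′ : VAll Lab ts′}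
      (ds : Pointwise* _≤ˡ_ ls ls′) ρ (r : _ → Fin k) (q : _ → Fin k′) us →
      (∀ i → lookup us (q i) ≡ lookup (skeletons* ds ρ r) i ^ lookup⁺ bs) →
        ctx* ls q ⟨ us ⟩* ≡ ctx* ls′ r
    skeleton-^ {l′ = free}          d ρ r = refl
    skeleton-^ {l′ = fun outside _} d ρ r = refl
    skeleton-^ {l′ = fun root _}    d ρ r = refl
    skeleton-^ {l = fun outside _} {fun {f} inner _} (fun _ ds) ρ r       =
      cong (fun f) (skeleton*-^ ds ρ r)
    skeleton-^ {l = fun root _}    {fun {f} inner _} (fun _ ds) (p ∷ ρ) r =
      trans (apply-^ p (skeletons* ds ρ r))
        (cong (fun f) (skeletons*-^ ds ρ r id _ (lookup-^* {bs = bs} (skeletons* ds ρ r))))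
    skeleton-^ {l = fun inner _}   {fun {f} inner _} (fun _ ds) ρ r       =
      cong (fun f) (skeleton*-^ ds ρ r)
    skeletons-^ {l = free}          d ρ r q us H = trans (H zero) (skeleton-^ d ρ r)
    skeletons-^ {l = fun outside _} d ρ r q us H = trans (H zero) (skeleton-^ d ρ r)
    skeletons-^ {l = fun root _}    d ρ r q us H = trans (H zero) (skeleton-^ d ρ r)
    skeletons-^ {l = fun inner _} {fun {f} inner _} (fun _ ds) ρ r q us H =
      cong (fun f) (skeletons*-^ ds ρ r q us H)
    skeleton*-^ [] ρ r = refl
    skeleton*-^ (d ∷ ds) ρ r = cong₂ _∷_ (skeleton-^ d _ _) (skeleton*-^ ds _ _)
    skeletons*-^ [] ρ r q us H = refl
    skeletons*-^ (d ∷ ds) ρ r q us H = cong₂ _∷_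
      (skeletons-^ d _ _ _ us
        (lookup-++-splitˡ (_^ lookup⁺ bs) (skeletons d _ _) (skeletons* ds _ _) H))
      (skeletons*-^ ds _ _ _ us
        (lookup-++-splitʳ (_^ lookup⁺ bs) (skeletons d _ _) (skeletons* ds _ _) H))

  data Every (P : ∀ {t} → Lab t → Set) : ∀ {m} {ts : Vec _ m} → VAll Lab ts → Set where
    []  : Every P []
    _∷_ : ∀ {t m} {l : Lab t} {ts : Vec _ m} {ls : VAll Lab ts} → P l → Every P ls →
      Every P (l ∷ ls)

  -- Only the condition below outside symbols is recorded. The condition at the root of the term is
  -- the separate `NonInner`, because validity is also needed for subterms within a pattern, whose
  -- top may be inner.
  data Valid : ∀ {t} → Lab t → Set where
    free    : ∀ {x} → Valid (free {x})
    outside : ∀ {f ts} {ls : VAll Lab ts} → Every NonInner ls → Every Valid ls →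
      Valid (fun {f} outside ls)
    root    : ∀ {f ts} {ls : VAll Lab ts} → Every Valid ls → Valid (fun {f} root ls)
    inner   : ∀ {f ts} {ls : VAll Lab ts} → Every Valid ls → Valid (fun {f} inner ls)

  module _ {n} {Θ : Vec ℕ n} (bs : VAll Term₁ Θ) {m} {Δ : Vec ℕ m} (ds : VAll Term₁ Δ) where

    -- Refinement with an image chosen separately for each occurrence of a 2nd-order variable; by
    -- linearity the images form one substitution (≼⇒⊑).
    data _≼_  : Term Θ 0 → Term Δ 0 → Set
    data _≼*_ : ∀ {m} → Vec (Term Θ 0) m → Vec (Term Δ 0) m → Set
    data _≼_ where
      free : ∀ {x} → free x ≼ free x
      fun  : ∀ {f Ms Ns} → Ms ≼* Ns → fun f Ms ≼ fun f Ns
      app  : ∀ {M Y Ns} (s : Term Θ (lookup Δ Y)) {Ms} → s ^ lookup⁺ bs ≡ lookup⁺ ds Y →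
        s ⟨ Ms ⟩ ≡ M → Ms ≼* Ns → M ≼ app Y Ns
    data _≼*_ where
      []  : [] ≼* []
      _∷_ : ∀ {M N m} {Ms : Vec _ m} {Ns} → M ≼ N → Ms ≼* Ns → (M ∷ Ms) ≼* (N ∷ Ns)

    ++-≼* : ∀ {k m} {Ms : Vec _ k} {Ns} {Ms′ : Vec _ m} {Ns′} → Ms ≼* Ns → Ms′ ≼* Ns′ →
      (Ms Vec.++ Ms′) ≼* (Ns Vec.++ Ns′)
    ++-≼* []       es = es
    ++-≼* (d ∷ ds) es = d ∷ ++-≼* ds es

    ≼-apply : ∀ {M p} (a : At ds p) (s : Term Θ (proj₁ p)) {Ms Ns} → s ^ lookup⁺ bs ≡ proj₂ p →
      s ⟨ Ms ⟩ ≡ M → Ms ≼* Ns → M ≼ apply a Ns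
    ≼-apply (at Y) s e e′ ds = app s e e′ ds

    -- The pointwise order implies refinement. Validity of `l′` lets the recursion meet an inner
    -- symbol of `l′` only inside one of its patterns, where `pieces-≼` passes through it down to
    -- the holes.
    body-≼    : ∀ {t t′} {l : Lab t} {l′ : Lab t′} → l ≤ l′ → Valid l′ → NonInner l′ →
      ∀ (ρ : All (At bs) (patterns l)) (ρ′ : All (At ds) (patterns l′)) → body l ρ ≼ body l′ ρ′
    pieces-≼  : ∀ {t t′} {l : Lab t} {l′ : Lab t′} (d : l ≤ l′) → Valid l′ →
      ∀ (ρ : All (At bs) (patterns l)) (ρ′ : All (At ds) (patterns l′)) → pieces d ρ ≼* args l′ ρ′
    body*-≼   : ∀ {m} {ts ts′ : Vec _ m} {ls : VAll Lab ts} {ls′ : VAll Lab ts′} →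
      Pointwise* _≤ˡ_ ls ls′ →
      Every Valid ls′ → Every NonInner ls′ →
        ∀ (ρ : All (At bs) (patterns* ls)) (ρ′ : All (At ds) (patterns* ls′)) →
        body* ls ρ ≼* body* ls′ ρ′
    pieces*-≼ : ∀ {m} {ts ts′ : Vec _ m} {ls : VAll Lab ts} {ls′ : VAll Lab ts′}
      (d : Pointwise* _≤ˡ_ ls ls′) →
      Every Valid ls′ → ∀ (ρ : All (At bs) (patterns* ls)) (ρ′ : All (At ds) (patterns* ls′)) →
        pieces* d ρ ≼* args* ls′ ρ′
    body-≼ free v n ρ ρ′ = free
    body-≼ (fun outside≤ les) (outside ns vs) n ρ ρ′ = fun (body*-≼ les vs ns ρ ρ′)
    body-≼ (fun outside≤ les) (root vs) n ρ (p ∷ ρ′) =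
      ≼-apply p (fun _ (skeleton* les ρ id)) (cong (fun _) (skeleton*-^ les ρ id))
        (cong (fun _) (skeleton*-⟨⟩ _ les ρ id λ _ → refl)) (pieces*-≼ les vs ρ ρ′)
    body-≼ (fun root≤root les) (root vs) n (q ∷ ρ) (p ∷ ρ′) =
      -- The coarser label is raised from root to inner for this call: at a root, `skeleton` would
      -- stop with a hole instead of covering the pattern.
      ≼-apply p (skeleton {l = fun root _} (fun ≤inner les) (q ∷ ρ) id)
        (skeleton-^ {l = fun root _} {fun inner _} (fun ≤inner les) (q ∷ ρ) id)
        (skeleton-⟨⟩ _ {l = fun root _} {fun inner _} (fun ≤inner les) (q ∷ ρ) id λ _ → refl)
          (pieces*-≼ les vs ρ ρ′)
    pieces-≼ d free                  ρ ρ′ = body-≼ d free free ρ ρ′ ∷ []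
    pieces-≼ d v@(outside _ _)       ρ ρ′ = body-≼ d v outside ρ ρ′ ∷ []
    pieces-≼ d v@(root _) ρ ρ′ = body-≼ d v root ρ ρ′ ∷ []
    pieces-≼ {l = fun outside _} (fun _ les) (inner vs) ρ       ρ′ = pieces*-≼ les vs ρ ρ′
    pieces-≼ {l = fun root _}    (fun _ les) (inner vs) (_ ∷ ρ) ρ′ = pieces*-≼ les vs ρ ρ′
    pieces-≼ {l = fun inner _}   (fun _ les) (inner vs) ρ       ρ′ = pieces*-≼ les vs ρ ρ′
    body*-≼ [] [] [] ρ ρ′ = []
    body*-≼ (le ∷ les) (v ∷ vs) (n ∷ ns) ρ ρ′ = body-≼ le v n _ _ ∷ body*-≼ les vs ns _ _
    pieces*-≼ [] [] ρ ρ′ = []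
    pieces*-≼ (le ∷ les) (v ∷ vs) ρ ρ′ = ++-≼* (pieces-≼ le v _ _) (pieces*-≼ les vs _ _)

    Image : Fin m → Set
    Image Y = Σ[ s ∈ Term Θ (lookup Δ Y) ] s ^ lookup⁺ bs ≡ lookup⁺ ds Y

    images  : ∀ {M N} → M ≼ N → List (Σ[ Y ∈ Fin m ] Image Y)
    images* : ∀ {k} {Ms : Vec _ k} {Ns} → Ms ≼* Ns → List (Σ[ Y ∈ Fin m ] Image Y)
    images free                = []
    images (fun ds)            = images* ds
    images (app {Y = Y} s e _ ds) = (Y , s , e) ∷ images* ds
    images* []       = []
    images* (d ∷ ds) = images d ++ images* ds

    keys-images  : ∀ {M N} (d : M ≼ N) → List.map proj₁ (images d) ≡ vars₂ N
    keys-images* : ∀ {m} {Ms : Vec _ m} {Ns} (d : Ms ≼* Ns) → List.map proj₁ (images* d) ≡ vars₂* Ns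
    keys-images free           = refl
    keys-images (fun ds)       = keys-images* ds
    keys-images (app s _ _ ds) = cong (_ ∷_) (keys-images* ds)
    keys-images* []       = refl
    keys-images* (d ∷ ds) =
      trans (map-++ proj₁ (images d) (images* ds)) (cong₂ _++_ (keys-images d) (keys-images* ds))

    module _ (σ : ∀ Y → Image Y) where
      Agrees : (Σ[ Y ∈ Fin m ] Image Y) → Set
      Agrees (Y , i) = σ Y ≡ i

      agrees-^  : ∀ {M N} (d : M ≼ N) → All Agrees (images d) → N ^ (proj₁ ∘ σ) ≡ M
      agrees-^* : ∀ {m} {Ms : Vec _ m} {Ns} (d : Ms ≼* Ns) → All Agrees (images* d) →
        Ns ^* (proj₁ ∘ σ) ≡ Ms
      agrees-^ free           as         = refl
      agrees-^ (fun ds)       as         = cong (fun _) (agrees-^* ds as)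
      agrees-^ (app s _ e ds) (eq ∷ as) = trans (cong₂ (λ i → i .proj₁ ⟨_⟩) eq (agrees-^* ds as)) e
      agrees-^* []       as = refl
      agrees-^* (d ∷ ds) as =
        cong₂ _∷_ (agrees-^ d (++⁻ˡ (images d) as)) (agrees-^* ds (++⁻ʳ (images d) as))

    -- The equation for `vars₂ N` expresses linearity and canonicity: the collected images have each
    -- variable as a key exactly once, in order, so `tabulate-keys` yields the substitution.
    ≼⇒⊑ : ∀ {M N} → M ≼ N → vars₂ N ≡ allFin m → (let[ Θ ] bs within M) ⊑ (let[ Δ ] ds within N)
    ≼⇒⊑ d all with σ , eq ← tabulate-keys (images d) (trans (keys-images d) all) =
        proj₁ ∘ σ
      , agrees-^ σ d (subst (All (Agrees σ)) (sym eq) (All.tabulate⁺ λ _ → refl))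
      , λ Y → trans (cong (_^ lookup⁺ bs) (app-^ {Δ = Δ} (proj₁ ∘ σ) Y)) (proj₂ (σ Y))

  toLet-⊑ : ∀ {t} {l l′ : Lab t} → l ≤ l′ → Valid l′ → NonInner l′ → toLet l ⊑ toLet l′
  toLet-⊑ {l′ = l′} d v n = ≼⇒⊑ _ _ (body-≼ _ _ d v n _ _) (vars₂-toLet l′)

  -- Relations between labellings

  module _ {R : Label → Label → Set} (R-refl : ∀ {a} → R a a) where
    Pointwise-refl  : ∀ {t} {l : Lab t} → Pointwise R l l
    Pointwise*-refl : ∀ {m} {ts : Vec _ m} {ls : VAll Lab ts} → Pointwise* R ls ls
    Pointwise-refl {l = free}     = free
    Pointwise-refl {l = fun a ls} = fun R-refl Pointwise*-refl
    Pointwise*-refl {ls = []}     = []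
    Pointwise*-refl {ls = l ∷ ls} = Pointwise-refl ∷ Pointwise*-refl

  module _ {R : Label → Label → Set} (R-trans : ∀ {a b c} → R a b → R b c → R a c) where
    Pointwise-trans  : ∀ {t t′ t″} {l : Lab t} {l′ : Lab t′} {l″ : Lab t″} → Pointwise R l l′ →
      Pointwise R l′ l″ → Pointwise R l l″
    Pointwise*-trans : ∀ {m} {ts ts′ ts″ : Vec _ m} {l : VAll Lab ts} {l′ : VAll Lab ts′}
      {l″ : VAll Lab ts″} →
      Pointwise* R l l′ → Pointwise* R l′ l″ → Pointwise* R l l″
    Pointwise-trans free       free       = free
    Pointwise-trans (fun a ds) (fun b es) = fun (R-trans a b) (Pointwise*-trans ds es)
    Pointwise*-trans []       []       = []
    Pointwise*-trans (d ∷ ds) (e ∷ es) = Pointwise-trans d e ∷ Pointwise*-trans ds es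

  ≅⇒≡   : ∀ {t} {l l′ : Lab t} → l ≅ l′ → l ≡ l′
  ≅*⇒≡  : ∀ {m} {ts : Vec _ m} {ls ls′ : VAll Lab ts} → Pointwise* _≡_ ls ls′ → ls ≡ ls′
  ≅⇒≡ free          = refl
  ≅⇒≡ (fun refl ds) = cong (fun _) (≅*⇒≡ ds)
  ≅*⇒≡ []       = refl
  ≅*⇒≡ (d ∷ ds) = cong₂ _∷_ (≅⇒≡ d) (≅*⇒≡ ds)

  -- The two translations are mutually inverse

  module _ {n} {Θ : Vec ℕ n} {bs : VAll Term₁ Θ} where
    lookup-label* : ∀ {m} (Ms : Vec _ m) i → lookup⁺ (label* bs Ms) i ≅ label bs (lookup Ms i)
    lookup-label* (M ∷ Ms) zero    = Pointwise-refl refl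
    lookup-label* (M ∷ Ms) (suc i) = lookup-label* Ms i

    label-apply : ∀ {p} (a : At bs p) Ms → label bs (apply a Ms) ≅ mark (proj₂ p) (label* bs Ms)
    label-apply (at X) Ms = Pointwise-refl refl

    -- Validity and `NonInner` keep the recursion away from the junk clause of `body`, whose inner
    -- symbol would be read back as outside.
    label-body  : ∀ {t} {l : Lab t} → Valid l → NonInner l → ∀ (ρ : All (At bs) (patterns l)) →
      label bs (body l ρ) ≅ l
    label-body* : ∀ {m} {ts : Vec _ m} {ls : VAll Lab ts} → Every Valid ls → Every NonInner ls →
      ∀ (ρ : All (At bs) (patterns* ls)) → Pointwise* _≡_ (label* bs (body* ls ρ)) ls
    plug-ctx  : ∀ {t} {l : Lab t} → Valid l →
      ∀ (ρ : All (At bs) (patterns l)) {k} {us : Vec _ k} (os : VAll Lab us) r →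
      (∀ i → lookup⁺ os (r i) ≅ label bs (lookup (args l ρ) i)) → plug (ctx l r) os ≅ l
    plug*-ctx : ∀ {m} {ts : Vec _ m} {ls : VAll Lab ts} → Every Valid ls →
      ∀ (ρ : All (At bs) (patterns* ls)) {k} {us : Vec _ k} (os : VAll Lab us) r →
      (∀ i → lookup⁺ os (r i) ≅ label bs (lookup (args* ls ρ) i)) →
        Pointwise* _≡_ (plug* (ctx* ls r) os) ls
    label-body free            n ρ       = free
    label-body (outside ns vs) n ρ       = fun refl (label-body* vs ns ρ)
    label-body {l = fun root ls} (root vs) n (p ∷ ρ) =
      Pointwise-trans trans (label-apply p (args* ls ρ))
      (fun refl (plug*-ctx vs ρ (label* bs (args* ls ρ)) id (lookup-label* (args* ls ρ))))
    label-body* []       []       ρ = []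
    label-body* (v ∷ vs) (n ∷ ns) ρ = label-body v n _ ∷ label-body* vs ns _
    plug-ctx v@free          ρ os r H = Pointwise-trans trans (H zero) (label-body v free ρ)
    plug-ctx v@(outside _ _) ρ os r H = Pointwise-trans trans (H zero) (label-body v outside ρ)
    plug-ctx v@(root _) ρ os r H = Pointwise-trans trans (H zero) (label-body v root ρ)
    plug-ctx (inner vs)      ρ os r H = fun refl (plug*-ctx vs ρ os r H)
    plug*-ctx []       ρ os r H = []
    plug*-ctx {ls = l ∷ ls} (v ∷ vs) ρ os r H =
        plug-ctx v _ os _
          (λ i → subst (λ M → lookup⁺ os _ ≅ label bs M) (lookup-++ˡ (args l _) (args* ls _) i)
          (H _))
      ∷ plug*-ctx vs _ os _
        (λ i → subst (λ M → lookup⁺ os _ ≅ label bs M) (lookup-++ʳ (args l _) (args* ls _) i) (H _))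

  plug-valid  : ∀ {k} (s : Term₁ k) {us : Vec _ k} (os : VAll Lab us) →
    (∀ j → Valid (lookup⁺ os j)) → Valid (plug s os)
  plug*-valid : ∀ {k m} (ss : Vec (Term₁ k) m) {us : Vec _ k} (os : VAll Lab us) →
    (∀ j → Valid (lookup⁺ os j)) → Every Valid (plug* ss os)
  plug-valid (free x)   os v = free
  plug-valid (bound j)  os v = v j
  plug-valid (fun f ss) os v = inner (plug*-valid ss os v)
  plug*-valid []       os v = []
  plug*-valid (s ∷ ss) os v = plug-valid s os v ∷ plug*-valid ss os v

  mark-valid : ∀ {k} (s : Term₁ k) {us : Vec _ k} (os : VAll Lab us) →
    (∀ j → Valid (lookup⁺ os j)) → Valid (mark s os)
  mark-valid (free x)   os v = free
  mark-valid (bound j)  os v = v j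
  mark-valid (fun f ss) os v = root (plug*-valid ss os v)

  mark-nonInner : ∀ {k} {s : Term₁ k} {us : Vec _ k} (os : VAll Lab us) → ¬ IsVariable s →
    NonInner (mark s os)
  mark-nonInner {s = free x}   os nv = free
  mark-nonInner {s = bound j}  os nv = contradiction (bound j) nv
  mark-nonInner {s = fun f ss} os nv = root

  lookup-Every : ∀ {P : ∀ {t} → Lab t → Set} {m} {ts : Vec _ m} {ls : VAll Lab ts} → Every P ls →
    ∀ j → P (lookup⁺ ls j)
  lookup-Every (p ∷ ps) zero    = p
  lookup-Every (p ∷ ps) (suc j) = lookup-Every ps j

  module _ {n} {Θ : Vec ℕ n} (bs : VAll Term₁ Θ)
    (arePatterns : ∀ X → IsPattern (lookup Θ X , lookup⁺ bs X)) where

    -- A binding that is not a variable supplies its own topmost symbol, labelled root, so the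
    -- labels of the arguments cannot surface at the top.
    label-nonInner  : ∀ M → NonInner (label bs M)
    label-nonInner (free x)   = free
    label-nonInner (fun f Ms) = outside
    label-nonInner (app X Ms) = mark-nonInner (label* bs Ms) (IsPattern.nonVariable (arePatterns X))

    label*-nonInner  : ∀ {m} (Ms : Vec _ m) → Every NonInner (label* bs Ms)
    label*-nonInner []       = []
    label*-nonInner (M ∷ Ms) = label-nonInner M ∷ label*-nonInner Ms

    label-valid  : ∀ M → Valid (label bs M)
    label*-valid : ∀ {m} (Ms : Vec _ m) → Every Valid (label* bs Ms)
    label-valid (free x)   = free
    label-valid (fun f Ms) = outside (label*-nonInner Ms) (label*-valid Ms)
    label-valid (app X Ms) =
      mark-valid (lookup⁺ bs X) (label* bs Ms) (lookup-Every (label*-valid Ms))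
    label*-valid []       = []
    label*-valid (M ∷ Ms) = label-valid M ∷ label*-valid Ms

    patternOf : Fin n → Pattern
    patternOf X = lookup Θ X , lookup⁺ bs X

    -- Induction hypothesis for reading a let-expression off and building it again. It is relative
    -- to `vars₂ M`, because a subterm of the body uses only some of the variables, and it admits
    -- all pointers at the right positions, because the recursion slices their list.
    record Represents {t} (M : Term Θ 0) (l : Lab t) : Set where
      constructor represents
      field
        nonInner : NonInner l
        patterns-≡   : patterns l ≡ List.map patternOf (vars₂ M)
        body-≡   : (ρ : All (At bs) (patterns l)) → indices ρ ≡ vars₂ M → body l ρ ≡ M

    indices-split : ∀ ps {qs is js} (ρ : All (At bs) (ps ++ qs)) → ps ≡ List.map patternOf is →
      indices ρ ≡ is ++ js →
      indices (++⁻ˡ ps ρ) ≡ is × indices (++⁻ʳ ps ρ) ≡ js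
    indices-split ps {is = is} ρ e h = ++-splitˡ _ is len e′ , ++-splitʳ _ is len e′
      where
      e′ = trans (sym (indices-++ ps ρ)) h
      len = trans (length-indices (++⁻ˡ ps ρ)) (trans (cong length e) (length-map patternOf is))

    -- The lengths of the two vectors coincide only after matching on the pointer and the index
    -- equation, so the arguments are compared as lists.
    apply-≡ : ∀ {p X} {Ms : Vec (Term Θ 0) (lookup Θ X)} (a : At bs p) (ts : Vec _ (proj₁ p)) →
      index a ≡ X → Vec.toList ts ≡ Vec.toList Ms → apply a ts ≡ app X Ms
    apply-≡ (at X) ts refl e = cong (app X) (toList-injective _ _ e)

    args-nonInner : ∀ {t} {l : Lab t} → NonInner l → ∀ ρ →
      Vec.toList (args {bs = bs} l ρ) ≡ List.[ body l ρ ]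
    args-nonInner free    ρ = refl
    args-nonInner outside ρ = refl
    args-nonInner root    ρ = refl

    holes-nonInner : ∀ {t} {l : Lab t} → NonInner l → holes l ≡ 1
    holes-nonInner free    = refl
    holes-nonInner outside = refl
    holes-nonInner root    = refl

    ctx-nonInner : ∀ {t} {l : Lab t} → NonInner l → ∀ {k} {j : Fin k} r →
      List.tabulate r ≡ List.[ j ] → ctx l r ≡ bound j
    ctx-nonInner free    r refl = refl
    ctx-nonInner outside r refl = refl
    ctx-nonInner root    r refl = refl

    module _ {k} {us : Vec _ k} (os : VAll Lab us) (Ms : Vec _ k)
      (D : ∀ j → Represents (lookup Ms j) (lookup⁺ os j)) where
      private
        closedˡ : ∀ {m} (s : Term₁ k) (ss : Vec _ m) → frees* (s ∷ ss) ≡ [] → frees s ≡ []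
        closedˡ s ss = ++-conicalˡ (frees s) _
        closedʳ : ∀ {m} (s : Term₁ k) (ss : Vec _ m) → frees* (s ∷ ss) ≡ [] → frees* ss ≡ []
        closedʳ s ss = ++-conicalʳ (frees s) _

        occs : List (Fin k) → List (Fin n)
        occs = concatMap (λ j → vars₂ (lookup Ms j))

      -- Each argument is non-inner and fills exactly one hole. Closedness excludes free variables
      -- of `s`, each of which would be cut out as a further hole.
      holes-plug  : ∀ s → frees s ≡ [] → holes (plug s os) ≡ length (bounds s)
      holes-plug* : ∀ {m} (ss : Vec _ m) → frees* ss ≡ [] →
        holes* (plug* ss os) ≡ length (bounds* ss)
      holes-plug (bound j)  c = holes-nonInner (Represents.nonInner (D j))
      holes-plug (fun f ss) c = holes-plug* ss c
      holes-plug* []       c = refl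
      holes-plug* (s ∷ ss) c =
        trans (cong₂ _+_ (holes-plug s (closedˡ s ss c)) (holes-plug* ss (closedʳ s ss c)))
        (sym (length-++ (bounds s)))

      ctx-plug  : ∀ s → frees s ≡ [] → ∀ r → List.tabulate r ≡ bounds s → ctx (plug s os) r ≡ s
      ctx-plug* : ∀ {m} (ss : Vec _ m) → frees* ss ≡ [] → ∀ r → List.tabulate r ≡ bounds* ss →
        ctx* (plug* ss os) r ≡ ss
      ctx-plug (bound j)  c r e = ctx-nonInner (Represents.nonInner (D j)) r e
      ctx-plug (fun f ss) c r e = cong (fun f) (ctx-plug* ss c r e)
      ctx-plug* []       c r e = refl
      ctx-plug* (s ∷ ss) c r e = cong₂ _∷_
          (ctx-plug s (closedˡ s ss c) _ (++-splitˡ _ (bounds s) len e′))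
          (ctx-plug* ss (closedʳ s ss c) _ (++-splitʳ _ (bounds s) len e′))
        where
        e′ = trans (sym (tabulate-+ (holes (plug s os)) r)) e
        len = trans (length-tabulate (r ∘ (_↑ˡ holes* (plug* ss os))))
          (holes-plug s (closedˡ s ss c))

      patterns-plug  : ∀ s → frees s ≡ [] →
        patterns (plug s os) ≡ List.map patternOf (occs (bounds s))
      patterns-plug* : ∀ {m} (ss : Vec _ m) → frees* ss ≡ [] →
        patterns* (plug* ss os) ≡ List.map patternOf (occs (bounds* ss))
      patterns-plug (bound j)  c =
        trans (Represents.patterns-≡ (D j)) (cong (List.map patternOf) (sym (++-identityʳ _)))
      patterns-plug (fun f ss) c = patterns-plug* ss c
      patterns-plug* []       c = refl
      patterns-plug* (s ∷ ss) c =
        trans (cong₂ _++_ (patterns-plug s (closedˡ s ss c)) (patterns-plug* ss (closedʳ s ss c)))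
        (trans (sym (map-++ patternOf (occs (bounds s)) _))
          (cong (List.map patternOf) (sym (concatMap-++ _ (bounds s) (bounds* ss)))))

      args-plug  : ∀ s → frees s ≡ [] → ∀ ρ → indices ρ ≡ occs (bounds s) →
        Vec.toList (args {bs = bs} (plug s os) ρ) ≡ List.map (lookup Ms) (bounds s)
      args-plug* : ∀ {m} (ss : Vec _ m) → frees* ss ≡ [] → ∀ ρ → indices ρ ≡ occs (bounds* ss) →
        Vec.toList (args* {bs = bs} (plug* ss os) ρ) ≡ List.map (lookup Ms) (bounds* ss)
      args-plug (bound j)  c ρ e =
        trans (args-nonInner (Represents.nonInner (D j)) ρ)
        (cong List.[_] (Represents.body-≡ (D j) ρ (trans e (++-identityʳ _))))
      args-plug (fun f ss) c ρ e = args-plug* ss c ρ e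
      args-plug* []       c ρ e = refl
      args-plug* (s ∷ ss) c ρ e
        with eˡ , eʳ ← indices-split (patterns (plug s os)) ρ (patterns-plug s (closedˡ s ss c))
          (trans e (concatMap-++ _ (bounds s) (bounds* ss))) =
        trans (toList-++ (args (plug s os) _) _)
          (trans (cong₂ _++_ (args-plug s (closedˡ s ss c) _ eˡ)
            (args-plug* ss (closedʳ s ss c) _ eʳ))
            (sym (map-++ (lookup Ms) (bounds s) (bounds* ss))))

    -- The number of holes equals the declared arity only propositionally. The transport is moved
    -- into the renaming of the holes, where `ctx-plug` can absorb it.
    rename-id : ∀ {h k} (e : h ≡ k) (F : ∀ {k} → (Fin h → Fin k) → Term₁ k) →
      _≡_ {A = Pattern} (h , F id) (k , F (subst Fin e))
    rename-id refl F = refl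

    vars₂*-concatMap : ∀ {k m} (Ms : Vec (Term Θ k) m) → concatMap vars₂ (Vec.toList Ms) ≡ vars₂* Ms
    vars₂*-concatMap []       = refl
    vars₂*-concatMap (M ∷ Ms) = cong (vars₂ M ++_) (vars₂*-concatMap Ms)

    -- The binding of `X` is generalised to `s` with an equation, so that it can be matched on while
    -- `X` stays abstract.
    mark-represents : ∀ X {us : Vec _ (lookup Θ X)} (os : VAll Lab us) Ms →
      (∀ j → Represents (lookup Ms j) (lookup⁺ os j)) →
      ∀ s → lookup⁺ bs X ≡ s → IsPattern (_ , s) → Represents (app X Ms) (mark s os)
    mark-represents X os Ms D (free x)   _ p = contradiction (free x) (IsPattern.nonVariable p)
    mark-represents X os Ms D (bound j)  _ p = contradiction (bound j) (IsPattern.nonVariable p)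
    mark-represents X os Ms D s@(fun f ss) eq (isPattern _ c e) = represents root
      (cong₂ _∷_ pat (trans (patterns-plug* os Ms D ss c) (cong (List.map patternOf) occ)))
      λ { (p ∷ ρ) h →
        apply-≡ p _ (∷-injectiveˡ h)
        (trans (args-plug* os Ms D ss c ρ (trans (∷-injectiveʳ h) (sym occ)))
                 (trans (cong (List.map (lookup Ms)) e) (map-lookup-allFin Ms))) }
      where
      h≡k : holes* (plug* ss os) ≡ lookup Θ X
      h≡k = trans (holes-plug* os Ms D ss c) (trans (cong length e) (length-tabulate id))

      pat : (holes* (plug* ss os) , fun f (ctx* (plug* ss os) id)) ≡ patternOf X
      pat = trans (rename-id h≡k λ r → fun f (ctx* (plug* ss os) r))
        (cong (_ ,_)
          (trans (cong (fun f)
          (ctx-plug* os Ms D ss c (subst Fin h≡k) (trans (tabulate-subst h≡k) (sym e)))) (sym eq)))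

      -- By `e` each λ-bound variable occurs once and in order, so the variables below the holes
      -- come in the order of the arguments of `X`.
      occ : concatMap (λ j → vars₂ (lookup Ms j)) (bounds* ss) ≡ vars₂* Ms
      occ = trans (cong (concatMap _) e)
        (trans (concatMap-lookup-allFin vars₂ Ms) (vars₂*-concatMap Ms))

    label-represents  : ∀ M → Represents M (label bs M)
    label*-represents : ∀ {m} (Ms : Vec _ m) j → Represents (lookup Ms j) (lookup⁺ (label* bs Ms) j)
    label*-pats : ∀ {m} (Ms : Vec _ m) → patterns* (label* bs Ms) ≡ List.map patternOf (vars₂* Ms)
    label*-body : ∀ {m} (Ms : Vec _ m) (ρ : All (At bs) (patterns* (label* bs Ms))) →
      indices ρ ≡ vars₂* Ms → body* (label* bs Ms) ρ ≡ Ms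
    label-represents (free x)   = represents free refl λ _ _ → refl
    label-represents (fun f Ms) = represents outside (label*-pats Ms) λ ρ e →
      cong (fun f) (label*-body Ms ρ e)
    label-represents (app X Ms) =
      mark-represents X (label* bs Ms) Ms (label*-represents Ms) (lookup⁺ bs X) refl (arePatterns X)
    label*-represents (M ∷ Ms) zero    = label-represents M
    label*-represents (M ∷ Ms) (suc j) = label*-represents Ms j
    label*-pats []       = refl
    label*-pats (M ∷ Ms) =
      trans (cong₂ _++_ (Represents.patterns-≡ (label-represents M)) (label*-pats Ms))
      (sym (map-++ patternOf (vars₂ M) (vars₂* Ms)))
    label*-body []       ρ e = refl
    label*-body (M ∷ Ms) ρ e
      with eˡ , eʳ ← indices-split (patterns (label bs M)) ρ
        (Represents.patterns-≡ (label-represents M)) e =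
      cong₂ _∷_ (Represents.body-≡ (label-represents M) _ eˡ) (label*-body Ms _ eʳ)

  context : List Pattern → Context
  context ps = length ps , patternArities ps , patternBindings ps

  context-patterns : ∀ {n} {Θ : Vec ℕ n} (bs : VAll Term₁ Θ) →
    context (List.tabulate (λ X → lookup Θ X , lookup⁺ bs X)) ≡ (n , Θ , bs)
  context-patterns []       = refl
  context-patterns (s ∷ bs) =
    cong (λ { (n , Θ , bs) → suc n , _ ∷ Θ , s ∷ bs }) (context-patterns bs)

  -- Size, arities and bindings are equated as one bundled `context`: matching it with `refl`
  -- identifies all three at once and makes the two bodies comparable.
  toLet-≡ : ∀ {t} (l : Lab t) {n Θ bs} (M : Term {n} Θ 0) → context (patterns l) ≡ (n , Θ , bs) →
    vars₂ M ≡ allFin n →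
    ((ρ : All (At bs) (patterns l)) → indices ρ ≡ vars₂ M → body l ρ ≡ M) →
      toLet l ≡ let[ Θ ] bs within M
  toLet-≡ l M refl e H =
    cong (let[ _ ] _ within_)
    (H (pointers (patterns l)) (trans (indices-pointers (patterns l)) (sym e)))

  toLet-label : ∀ {n} {Θ : Vec ℕ n} (bs : VAll Term₁ Θ) →
    (∀ X → IsPattern (lookup Θ X , lookup⁺ bs X)) →
    ∀ M → vars₂ M ≡ allFin n → toLet (label bs M) ≡ let[ Θ ] bs within M
  toLet-label bs arePatterns M e = toLet-≡ (label bs M) M
    (trans (cong context
      (trans (Represents.patterns-≡ D) (trans (cong (List.map _) e) (map-tabulate id _))))
      (context-patterns bs)) e
    (Represents.body-≡ D)
    where D = label-represents bs arePatterns M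

  -- The lattice of labellings

  ≤-antisym   : ∀ {t} {l l′ : Lab t} → l ≤ l′ → l′ ≤ l → l ≡ l′
  ≤*-antisym  : ∀ {m} {ts : Vec _ m} {ls ls′ : VAll Lab ts} → Pointwise* _≤ˡ_ ls ls′ →
    Pointwise* _≤ˡ_ ls′ ls → ls ≡ ls′
  ≤-antisym free       free       = refl
  ≤-antisym (fun a ds) (fun b es) = cong₂ fun (≤ˡ-antisym a b) (≤*-antisym ds es)
  ≤*-antisym []       []       = refl
  ≤*-antisym (d ∷ ds) (e ∷ es) = cong₂ _∷_ (≤-antisym d e) (≤*-antisym ds es)

  module Zip (_∙_ : Op₂ Label) where
    zip  : ∀ {t} → Op₂ (Lab t)
    zip* : ∀ {m} {ts : Vec _ m} → Op₂ (VAll Lab ts)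
    zip free       free       = free
    zip (fun a ls) (fun b ks) = fun (a ∙ b) (zip* ls ks)
    zip* []       []       = []
    zip* (l ∷ ls) (k ∷ ks) = zip l k ∷ zip* ls ks

    module _ {R : Label → Label → Set} (H : ∀ a b → R (a ∙ b) a) where
      zip-relˡ  : ∀ {t} (l k : Lab t) → Pointwise R (zip l k) l
      zip*-relˡ : ∀ {m} {ts : Vec _ m} (ls ks : VAll Lab ts) → Pointwise* R (zip* ls ks) ls
      zip-relˡ free       free       = free
      zip-relˡ (fun a ls) (fun b ks) = fun (H a b) (zip*-relˡ ls ks)
      zip*-relˡ []       []       = []
      zip*-relˡ (l ∷ ls) (k ∷ ks) = zip-relˡ l k ∷ zip*-relˡ ls ks

    module _ {R : Label → Label → Set} (H : ∀ a b → R (a ∙ b) b) where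
      zip-relʳ  : ∀ {t} (l k : Lab t) → Pointwise R (zip l k) k
      zip*-relʳ : ∀ {m} {ts : Vec _ m} (ls ks : VAll Lab ts) → Pointwise* R (zip* ls ks) ks
      zip-relʳ free       free       = free
      zip-relʳ (fun a ls) (fun b ks) = fun (H a b) (zip*-relʳ ls ks)
      zip*-relʳ []       []       = []
      zip*-relʳ (l ∷ ls) (k ∷ ks) = zip-relʳ l k ∷ zip*-relʳ ls ks

    module _ {R : Label → Label → Set} (H : ∀ {a b c} → R b a → R c a → R (b ∙ c) a) where
      zip-universal  : ∀ {t} {j k l : Lab t} → Pointwise R k j → Pointwise R l j →
        Pointwise R (zip k l) j
      zip*-universal : ∀ {m} {ts : Vec _ m} {js ks ls : VAll Lab ts} →
        Pointwise* R ks js → Pointwise* R ls js → Pointwise* R (zip* ks ls) js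
      zip-universal free       free       = free
      zip-universal (fun a ds) (fun b es) = fun (H a b) (zip*-universal ds es)
      zip*-universal []       []       = []
      zip*-universal (d ∷ ds) (e ∷ es) = zip-universal d e ∷ zip*-universal ds es

  module _ {R : Label → Label → Set} where
    -- The lemmas of `Zip` have `zip` on the left of the relation; reversing it makes them serve
    -- joins and meets alike.
    flip  : ∀ {t t′} {l : Lab t} {l′ : Lab t′} → Pointwise (λ a b → R b a) l l′ → Pointwise R l′ l
    flip* : ∀ {m} {ts ts′ : Vec _ m} {l : VAll Lab ts} {l′ : VAll Lab ts′} →
      Pointwise* (λ a b → R b a) l l′ → Pointwise* R l′ l
    flip free       = free
    flip (fun a ds) = fun a (flip* ds)
    flip* []       = []
    flip* (d ∷ ds) = flip d ∷ flip* ds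

  open Zip _∧ˡ_ using () renaming (zip to _∧_; zip* to _∧*_)
  open Zip _∨ˡ_ using () renaming (zip to _∨_; zip* to _∨*_)

  ∧-distribˡ-∨ : ∀ {t} (x y z : Lab t) → x ∧ (y ∨ z) ≡ (x ∧ y) ∨ (x ∧ z)
  ∧*-distribˡ-∨* : ∀ {m} {ts : Vec _ m} (x y z : VAll Lab ts) → x ∧* (y ∨* z) ≡ (x ∧* y) ∨* (x ∧* z)
  ∧-distribˡ-∨ free       free       free       = refl
  ∧-distribˡ-∨ (fun a xs) (fun b ys) (fun c zs) =
    cong₂ fun (∧ˡ-distribˡ-∨ˡ a b c) (∧*-distribˡ-∨* xs ys zs)
  ∧*-distribˡ-∨* []       []       []       = refl
  ∧*-distribˡ-∨* (x ∷ xs) (y ∷ ys) (z ∷ zs) =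
    cong₂ _∷_ (∧-distribˡ-∨ x y z) (∧*-distribˡ-∨* xs ys zs)

  ∧-nonInner : ∀ {t} {l k : Lab t} → NonInner l → NonInner (l ∧ k)
  ∧-nonInner {k = free}          free    = free
  ∧-nonInner {k = fun _ _}       outside = outside
  ∧-nonInner {k = fun outside _} root    = outside
  ∧-nonInner {k = fun root _}    root    = root
  ∧-nonInner {k = fun inner _}   root    = root

  ∧-nonInnerʳ : ∀ {t} {l k : Lab t} → NonInner k → NonInner (l ∧ k)
  ∧-nonInnerʳ {l = free}          free    = free
  ∧-nonInnerʳ {l = fun outside _} outside = outside
  ∧-nonInnerʳ {l = fun root _}    outside = outside
  ∧-nonInnerʳ {l = fun inner _}   outside = outside
  ∧-nonInnerʳ {l = fun outside _} root    = outside
  ∧-nonInnerʳ {l = fun root _}    root    = root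
  ∧-nonInnerʳ {l = fun inner _}   root    = root

  ∨-nonInner : ∀ {t} {l k : Lab t} → NonInner l → NonInner k → NonInner (l ∨ k)
  ∨-nonInner free    free    = free
  ∨-nonInner outside outside = outside
  ∨-nonInner outside root    = root
  ∨-nonInner root    outside = root
  ∨-nonInner root    root    = root

  ∧*-nonInner : ∀ {m} {ts : Vec _ m} {l k : VAll Lab ts} → Every NonInner l →
    Every NonInner (l ∧* k)
  ∧*-nonInner {k = []}    []       = []
  ∧*-nonInner {k = _ ∷ _} (n ∷ ns) = ∧-nonInner n ∷ ∧*-nonInner ns

  ∧*-nonInnerʳ : ∀ {m} {ts : Vec _ m} {l k : VAll Lab ts} → Every NonInner k →
    Every NonInner (l ∧* k)
  ∧*-nonInnerʳ {l = []}    []       = []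
  ∧*-nonInnerʳ {l = _ ∷ _} (n ∷ ns) = ∧-nonInnerʳ n ∷ ∧*-nonInnerʳ ns

  ∨*-nonInner : ∀ {m} {ts : Vec _ m} {l k : VAll Lab ts} → Every NonInner l → Every NonInner k →
    Every NonInner (l ∨* k)
  ∨*-nonInner []       []       = []
  ∨*-nonInner (n ∷ ns) (k ∷ ks) = ∨-nonInner n k ∷ ∨*-nonInner ns ks

  -- A meet in the chain is outside only if one of its factors is. The children of that factor are
  -- non-inner, and meets only lower their labels.
  ∧-valid  : ∀ {t} {l k : Lab t} → Valid l → Valid k → Valid (l ∧ k)
  ∧*-valid : ∀ {m} {ts : Vec _ m} {l k : VAll Lab ts} → Every Valid l → Every Valid k →
    Every Valid (l ∧* k)
  ∧-valid free free = free
  ∧-valid (outside ns vs) (outside _ ws)  = outside (∧*-nonInner ns) (∧*-valid vs ws)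
  ∧-valid (outside ns vs) (root ws)       = outside (∧*-nonInner ns) (∧*-valid vs ws)
  ∧-valid (outside ns vs) (inner ws)      = outside (∧*-nonInner ns) (∧*-valid vs ws)
  ∧-valid (root vs)       (outside ns ws) = outside (∧*-nonInnerʳ ns) (∧*-valid vs ws)
  ∧-valid (root vs)       (root ws)       = root (∧*-valid vs ws)
  ∧-valid (root vs)       (inner ws)      = root (∧*-valid vs ws)
  ∧-valid (inner vs)      (outside ns ws) = outside (∧*-nonInnerʳ ns) (∧*-valid vs ws)
  ∧-valid (inner vs)      (root ws)       = root (∧*-valid vs ws)
  ∧-valid (inner vs)      (inner ws)      = inner (∧*-valid vs ws)
  ∧*-valid []       []       = []
  ∧*-valid (v ∷ vs) (w ∷ ws) = ∧-valid v w ∷ ∧*-valid vs ws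

  -- A join is outside only if both labels are; then both sets of children are non-inner, and
  -- `inner` is not a join of smaller labels.
  ∨-valid  : ∀ {t} {l k : Lab t} → Valid l → Valid k → Valid (l ∨ k)
  ∨*-valid : ∀ {m} {ts : Vec _ m} {l k : VAll Lab ts} → Every Valid l → Every Valid k →
    Every Valid (l ∨* k)
  ∨-valid free free = free
  ∨-valid (outside ns vs) (outside ms ws) = outside (∨*-nonInner ns ms) (∨*-valid vs ws)
  ∨-valid (outside _ vs)  (root ws)       = root (∨*-valid vs ws)
  ∨-valid (outside _ vs)  (inner ws)      = inner (∨*-valid vs ws)
  ∨-valid (root vs)       (outside _ ws)  = root (∨*-valid vs ws)
  ∨-valid (root vs)       (root ws)       = root (∨*-valid vs ws)
  ∨-valid (root vs)       (inner ws)      = inner (∨*-valid vs ws)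
  ∨-valid (inner vs)      (outside _ ws)  = inner (∨*-valid vs ws)
  ∨-valid (inner vs)      (root ws)       = inner (∨*-valid vs ws)
  ∨-valid (inner vs)      (inner ws)      = inner (∨*-valid vs ws)
  ∨*-valid []       []       = []
  ∨*-valid (v ∷ vs) (w ∷ ws) = ∨-valid v w ∷ ∨*-valid vs ws

  _≟ᴸ_  : ∀ {t} → Decidable {A = Lab t} _≡_
  _≟ᴸ*_ : ∀ {m} {ts : Vec _ m} → Decidable {A = VAll Lab ts} _≡_
  free     ≟ᴸ free     = yes refl
  fun a ls ≟ᴸ fun b ks =
    map′ (λ { (refl , refl) → refl }) (λ { refl → refl , refl }) ((a ≟ˡ b) ×-dec (ls ≟ᴸ* ks))
  []       ≟ᴸ* []       = yes refl
  (l ∷ ls) ≟ᴸ* (k ∷ ks) =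
    map′ (λ { (refl , refl) → refl }) (λ { refl → refl , refl }) ((l ≟ᴸ k) ×-dec (ls ≟ᴸ* ks))

  -- Enumeration of the labellings

  labels : List Label
  labels = outside ∷ root ∷ inner ∷ []

  ∈-labels : ∀ a → a ∈ labels
  ∈-labels outside = here refl
  ∈-labels root    = there (here refl)
  ∈-labels inner   = there (there (here refl))

  labellings  : ∀ t → List (Lab t)
  labellings* : ∀ {m} (ts : Vec _ m) → List (VAll Lab ts)
  labellings (free x)   = free ∷ []
  labellings (fun f ts) = List.cartesianProductWith fun labels (labellings* ts)
  labellings* []       = [] ∷ []
  labellings* (t ∷ ts) = List.cartesianProductWith _∷_ (labellings t) (labellings* ts)

  ∈-labellings  : ∀ {t} (l : Lab t) → l ∈ labellings t
  ∈-labellings* : ∀ {m} {ts : Vec _ m} (ls : VAll Lab ts) → ls ∈ labellings* ts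
  ∈-labellings free       = here refl
  ∈-labellings (fun a ls) = ∈-cartesianProductWith⁺ fun (∈-labels a) (∈-labellings* ls)
  ∈-labellings* []       = here refl
  ∈-labellings* (l ∷ ls) = ∈-cartesianProductWith⁺ _∷_ (∈-labellings l) (∈-labellings* ls)

  -- The greatest element

  inners  : ∀ t → Lab t
  inners* : ∀ {m} (ts : Vec _ m) → VAll Lab ts
  inners (free x)   = free
  inners (fun f ts) = fun inner (inners* ts)
  inners* []       = []
  inners* (t ∷ ts) = inners t ∷ inners* ts

  top : ∀ t → Lab t
  top (free x)   = free
  top (fun f ts) = fun root (inners* ts)

  inners-valid  : ∀ t → Valid (inners t)
  inners*-valid : ∀ {m} (ts : Vec _ m) → Every Valid (inners* ts)
  inners-valid (free x)   = free
  inners-valid (fun f ts) = inner (inners*-valid ts)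
  inners*-valid []       = []
  inners*-valid (t ∷ ts) = inners-valid t ∷ inners*-valid ts

  top-valid : ∀ t → Valid (top t)
  top-valid (free x)   = free
  top-valid (fun f ts) = root (inners*-valid ts)

  top-nonInner : ∀ t → NonInner (top t)
  top-nonInner (free x)   = free
  top-nonInner (fun f ts) = root

  ≤-inners  : ∀ {t} (l : Lab t) → l ≤ inners t
  ≤-inners* : ∀ {m} {ts : Vec _ m} (ls : VAll Lab ts) → Pointwise* _≤ˡ_ ls (inners* ts)
  ≤-inners free       = free
  ≤-inners (fun a ls) = fun ≤inner (≤-inners* ls)
  ≤-inners* []       = []
  ≤-inners* (l ∷ ls) = ≤-inners l ∷ ≤-inners* ls

  ≤-top : ∀ {t} {l : Lab t} → NonInner l → l ≤ top t
  ≤-top free    = free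
  ≤-top outside = fun outside≤ (≤-inners* _)
  ≤-top root    = fun root≤root (≤-inners* _)

  patterns-inners  : ∀ t → patterns (inners t) ≡ []
  patterns-inners* : ∀ {m} (ts : Vec _ m) → patterns* (inners* ts) ≡ []
  patterns-inners (free x)   = refl
  patterns-inners (fun f ts) = patterns-inners* ts
  patterns-inners* []       = refl
  patterns-inners* (t ∷ ts) = cong₂ _++_ (patterns-inners t) (patterns-inners* ts)

  -- Only variable occurrences interrupt a pattern that is inner throughout, so its holes are the
  -- entries of the vector of variables in ⊤.
  holes-inners  : ∀ t → holes (inners t) ≡ length (frees t)
  holes-inners* : ∀ {m} (ts : Vec _ m) → holes* (inners* ts) ≡ length (frees* ts)
  holes-inners (free x)   = refl
  holes-inners (fun f ts) = holes-inners* ts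
  holes-inners* []       = refl
  holes-inners* (t ∷ ts) =
    trans (cong₂ _+_ (holes-inners t) (holes-inners* ts)) (sym (length-++ (frees t)))

  module _ {n} {Θ : Vec ℕ n} {bs : VAll Term₁ Θ} where
    args-inners  : ∀ t (ρ : All (At bs) (patterns (inners t))) →
      Vec.toList (args (inners t) ρ) ≡ List.map free (frees t)
    args-inners* : ∀ {m} (ts : Vec _ m) (ρ : All (At bs) (patterns* (inners* ts))) →
      Vec.toList (args* (inners* ts) ρ) ≡ List.map free (frees* ts)
    args-inners (free x)   ρ = refl
    args-inners (fun f ts) ρ = args-inners* ts ρ
    args-inners* []       ρ = refl
    args-inners* (t ∷ ts) ρ = trans (toList-++ (args (inners t) _) _)
      (trans (cong₂ _++_ (args-inners t _) (args-inners* ts _))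
        (sym (map-++ free (frees t) (frees* ts))))

  -- h and k are equal only propositionally, which forces the subst on the binding
  let-single : ∀ {h k} (s : Term₁ h) ps (e : h ≡ k) → ps ≡ [] →
    (as : Vec (Term (h ∷ patternArities ps) 0) h) {xs : Vec Variable k} →
      Vec.toList as ≡ List.map free (Vec.toList xs) →
    let[ h ∷ patternArities ps ] (s ∷ patternBindings ps) within app zero as
      ≡ let[ k ∷ [] ] (subst Term₁ e s ∷ []) within app zero (Vec.map free xs)
  let-single s [] refl refl as {xs} e =
    cong (λ as → let[ _ ] _ within app zero as)
    (toList-injective as _ (trans e (sym (toList-map free xs))))

  -- A variable has no function symbol from which a pattern could be formed: its greatest
  -- multipattern is the empty let-expression.
  toLet-top : ∀ t → ¬ IsVariable t → ∃[ t′ ] toLet (top t) ≡ singleLet t t′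
  toLet-top (free x)   nv = contradiction (free x) nv
  toLet-top (fun f ts) nv =
    _ , let-single (fun f (ctx* (inners* ts) id)) (patterns* (inners* ts)) (holes-inners* ts)
    (patterns-inners* ts) _
    (trans (args-inners* ts _) (cong (List.map free) (sym (toList∘fromList (frees* ts)))))

  -- The least element

  ^-empty  : ∀ {k} (t : Term₁ k) (σ : Subst₂ [] []) → t ^ σ ≡ t
  ^-empty* : ∀ {k m} (ts : Vec (Term₁ k) m) (σ : Subst₂ [] []) → ts ^* σ ≡ ts
  ^-empty (free x)   σ = refl
  ^-empty (bound j)  σ = refl
  ^-empty (fun f ts) σ = cong (fun f) (^-empty* ts σ)
  ^-empty* []       σ = refl
  ^-empty* (t ∷ ts) σ = cong₂ _∷_ (^-empty t σ) (^-empty* ts σ)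

  vars₂-none  : ∀ {k} (t : Term₁ k) → vars₂ t ≡ []
  vars₂-none t with vars₂ t
  ... | [] = refl

  bottom : ∀ t → MultipatternDenoting t
  bottom t = record
    { expr = emptyLet t
    ; isMultipattern = record
      { binding-nonVariable = λ ()
      ; binding-closed      = λ ()
      ; body-linear         = λ ()
      ; binding-linear      = λ ()
      ; body-canonical      = subst InOrder (sym (vars₂-none t)) []
      ; binding-canonical   = λ ()
      }
    ; denotes = ^-empty t _
    }

  -- The bindings of `m` themselves form the witnessing substitution, for which the first condition
  -- of refinement is the statement that `m` denotes `t`.
  bottom-⊑ : ∀ {t} (m : MultipatternDenoting t) → emptyLet t ⊑ expr m
  bottom-⊑ m = Let.binding (expr m) , MultipatternDenoting.denotes m ,
    λ Y → trans (^-empty _ _) (app-^ {Δ = Let.arities (expr m)} (Let.binding (expr m)) Y)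

  -- Transfer of the lattice structure to multipatterns

  module _ {L : Let 0} (I : IsMultipattern L) where
    private module L = Let L
    open IsMultipattern I

    binding-isPattern : ∀ X → IsPattern (lookup L.arities X , L.binding X)
    binding-isPattern X = isPattern (binding-nonVariable X) (binding-closed X)
      (inOrder-once⇒allFin _ (binding-canonical X) (binding-linear X))

    vars₂-all : vars₂ L.body ≡ allFin L.size
    vars₂-all = inOrder-once⇒allFin _ body-canonical body-linear

  labelLet : (L : Let 0) → Lab ⟦ L ⟧
  labelLet L = label (Let.bindings L) (Let.body L)

  module _ {L : Let 0} (I : IsMultipattern L) where
    labelLet-valid : Valid (labelLet L)
    labelLet-valid = label-valid (Let.bindings L) (binding-isPattern I) (Let.body L)

    labelLet-nonInner : NonInner (labelLet L)
    labelLet-nonInner = label-nonInner (Let.bindings L) (binding-isPattern I) (Let.body L)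

    toLet-labelLet : toLet (labelLet L) ≡ L
    toLet-labelLet = toLet-label (Let.bindings L) (binding-isPattern I) (Let.body L) (vars₂-all I)

  labelLet-mono : ∀ {L L′} → IsMultipattern L → IsMultipattern L′ → L ⊑ L′ →
    labelLet L ≤ labelLet L′
  labelLet-mono {L} {L′} I I′ (σ , N^σ≡M , σ-denotes) =
    subst (λ M → label bs M ≤ label ds (Let.body L′)) N^σ≡M
      (label-^ bs ds σ (IsMultipattern.binding-nonVariable I)
        (IsMultipattern.binding-nonVariable I′) σ-^ (Let.body L′))
    where
    bs = Let.bindings L
    ds = Let.bindings L′
    σ-^ : ∀ Y → σ Y ^ lookup⁺ bs ≡ lookup⁺ ds Y
    σ-^ Y = trans (cong (_^ lookup⁺ bs) (sym (app-^ {Δ = Let.arities L′} σ Y))) (σ-denotes Y)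

  module _ {t : Term₁ 0} where
    labelling : MultipatternDenoting t → Lab t
    labelling m = subst Lab (MultipatternDenoting.denotes m) (labelLet (expr m))

    subst-Lab : ∀ (P : ∀ {t} → Lab t → Set) {t t′} (e : t ≡ t′) {l : Lab t} → P l →
      P (subst Lab e l)
    subst-Lab P refl p = p

    labelling-valid : ∀ m → Valid (labelling m)
    labelling-valid m = subst-Lab Valid denotes (labelLet-valid isMultipattern)
      where open MultipatternDenoting m hiding (expr)

    labelling-nonInner : ∀ m → NonInner (labelling m)
    labelling-nonInner m = subst-Lab NonInner denotes (labelLet-nonInner isMultipattern)
      where open MultipatternDenoting m hiding (expr)

    toLet-labelling : ∀ m → toLet (labelling m) ≡ expr m
    toLet-labelling m = subst-Lab (λ l → toLet l ≡ expr m) denotes (toLet-labelLet isMultipattern)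
      where open MultipatternDenoting m hiding (expr)

    labelling-toMultipattern : ∀ {l} → Valid l → NonInner l → labelling (toMultipattern l) ≡ l
    labelling-toMultipattern {l} v n = ≅⇒≡ (subst-Lab (_≅ l) (body-^ l _) (label-body v n _))

    labelling-mono : ∀ {m m′} → expr m ⊑ expr m′ → labelling m ≤ labelling m′
    labelling-mono {m} {m′} m⊑m′ =
      subst-Lab (_≤ labelling m′) (denotes m) (subst-Lab (labelLet (expr m) ≤_) (denotes m′)
        (labelLet-mono (isMultipattern m) (isMultipattern m′) m⊑m′))
      where open MultipatternDenoting hiding (expr)

    labelling-cancel : ∀ {m m′} → labelling m ≤ labelling m′ → expr m ⊑ expr m′
    labelling-cancel {m} {m′} le =
      subst₂ _⊑_ (toLet-labelling m) (toLet-labelling m′)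
      (toLet-⊑ le (labelling-valid m′) (labelling-nonInner m′))

    -- Equality of multipatterns compares expressions and ignores `denotes`, along which `labelling`
    -- transports; uniqueness of identity proofs makes the two transports agree.
    labelling-cong : ∀ {m m′} → expr m ≡ expr m′ → labelling m ≡ labelling m′
    labelling-cong {m} {m′} refl =
      cong (λ e → subst Lab e (labelLet (expr m))) (≡-irrelevant (denotes m) (denotes m′))
      where
      open MultipatternDenoting hiding (expr)
      ≡-irrelevant : ∀ {t t′ : Term₁ 0} (p q : t ≡ t′) → p ≡ q
      ≡-irrelevant refl refl = refl

    labelling-injective : ∀ {m m′} → labelling m ≡ labelling m′ → expr m ≡ expr m′
    labelling-injective {m} {m′} e =
      trans (sym (toLet-labelling m)) (trans (cong toLet e) (toLet-labelling m′))

    _∨ᴹ_ _∧ᴹ_ : Op₂ (MultipatternDenoting t)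
    m ∨ᴹ m′ = toMultipattern (labelling m ∨ labelling m′)
    m ∧ᴹ m′ = toMultipattern (labelling m ∧ labelling m′)

    labelling-∨ : ∀ m m′ → labelling (m ∨ᴹ m′) ≡ labelling m ∨ labelling m′
    labelling-∨ m m′ =
      labelling-toMultipattern (∨-valid (labelling-valid m) (labelling-valid m′))
      (∨-nonInner (labelling-nonInner m) (labelling-nonInner m′))

    labelling-∧ : ∀ m m′ → labelling (m ∧ᴹ m′) ≡ labelling m ∧ labelling m′
    labelling-∧ m m′ =
      labelling-toMultipattern (∧-valid (labelling-valid m) (labelling-valid m′))
      (∧-nonInner (labelling-nonInner m))

    open Setoid (multipatternsDenoting t) using (_≈_)
    -- Since `labelling` preserves and reflects the order and is injective up to `_≈_`, the order
    -- laws and bounds are pulled back from labellings. Even transitivity of refinement is obtained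
    -- in this way, without composing substitutions.
    isDistributiveLattice : IsDistributiveLattice _≈_ (_⊑_ on expr {t}) _∨ᴹ_ _∧ᴹ_
    isDistributiveLattice = record
      { isLattice = record
        { isPartialOrder = record
          { isPreorder = record
            { isEquivalence = Setoid.isEquivalence (multipatternsDenoting t)
            ; reflexive =
              λ {m} {m′} e →
              labelling-cancel {m} {m′}
              (subst (_ ≤_) (labelling-cong {m} {m′} e) (Pointwise-refl ≤ˡ-refl))
            ; trans =
              λ {m} {m′} {m″} p q →
              labelling-cancel {m} {m″}
              (Pointwise-trans ≤ˡ-trans (labelling-mono {m} {m′} p) (labelling-mono {m′} {m″} q))
            }
          ; antisym =
            λ {m} {m′} p q →
            labelling-injective {m} {m′}
            (≤-antisym (labelling-mono {m} {m′} p) (labelling-mono {m′} {m} q))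
          }
        ; supremum = λ m m′ →
            labelling-cancel {m} {m ∨ᴹ m′}
              (subst (_ ≤_) (sym (labelling-∨ m m′)) (flip (Zip.zip-relˡ _∨ˡ_ ∨ˡ-upperˡ _ _)))
          , labelling-cancel {m′} {m ∨ᴹ m′}
            (subst (_ ≤_) (sym (labelling-∨ m m′)) (flip (Zip.zip-relʳ _∨ˡ_ ∨ˡ-upperʳ _ _)))
          , λ m″ p q → labelling-cancel {m ∨ᴹ m′} {m″} (subst (_≤ _) (sym (labelling-∨ m m′))
              (Zip.zip-universal _∨ˡ_ ∨ˡ-least (labelling-mono {m} {m″} p)
                (labelling-mono {m′} {m″} q)))
        ; infimum = λ m m′ →
            labelling-cancel {m ∧ᴹ m′} {m}
              (subst (_≤ _) (sym (labelling-∧ m m′)) (Zip.zip-relˡ _∧ˡ_ ∧ˡ-lowerˡ _ _))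
          , labelling-cancel {m ∧ᴹ m′} {m′}
            (subst (_≤ _) (sym (labelling-∧ m m′)) (Zip.zip-relʳ _∧ˡ_ ∧ˡ-lowerʳ _ _))
          , λ m″ p q → labelling-cancel {m″} {m ∧ᴹ m′} (subst (_ ≤_) (sym (labelling-∧ m m′))
              (flip (Zip.zip-universal _∧ˡ_ ∧ˡ-greatest (flip (labelling-mono {m″} {m} p))
                (flip (labelling-mono {m″} {m′} q)))))
        }
      -- Both sides are built by `toMultipattern`, so it suffices to equate the labellings it is
      -- given.
      ; ∧-distribˡ-∨ = λ x y z → cong toLet
          (trans (cong (labelling x ∧_) (labelling-∨ y z))
          (trans (∧-distribˡ-∨ (labelling x) (labelling y) (labelling z))
          (sym (cong₂ _∨_ (labelling-∧ x y) (labelling-∧ x z)))))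
      }

    decSetoid : DecSetoid 0ℓ 0ℓ
    decSetoid = record
      { isDecEquivalence = record
        { isEquivalence = Setoid.isEquivalence (multipatternsDenoting t)
        ; _≟_ = λ m m′ →
          map′ (labelling-injective {m} {m′}) (labelling-cong {m} {m′})
          (labelling m ≟ᴸ labelling m′)
        }
      }

    -- All labellings are enumerated, valid or not: `toMultipattern` is defined on each of them, and
    -- every multipattern is the image of its own labelling. The repetitions caused by invalid
    -- labellings disappear with deduplication.
    finite : Finite (multipatternsDenoting t)
    finite = enumerable⇒finite decSetoid (List.map toMultipattern (labellings t))
      λ m → Any.map⁺
        (Any.map (λ e → trans (sym (toLet-labelling m)) (cong toLet e))
        (∈-labellings (labelling m)))

    maximum : Maximum (_⊑_ on expr {t}) (toMultipattern (top t))
    maximum m = labelling-cancel {m} {toMultipattern (top t)}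
      (subst (labelling m ≤_) (sym (labelling-toMultipattern (top-valid t) (top-nonInner t)))
        (≤-top (labelling-nonInner m)))

lemma2 : (S : Signature) → let open Multipatterns S in
    (t : Term₁ 0) →
    let open Setoid (multipatternsDenoting t)
        _≤_ = _⊑_ on expr {t}
    in
      Finite (multipatternsDenoting t)
    × (∃[ join ] ∃[ meet ] IsDistributiveLattice _≈_ _≤_ join meet)
    × (Σ[ ⊥ ∈ Carrier ] Minimum _≤_ ⊥ × expr ⊥ ≡ emptyLet t)
    × (Σ[ ⊤ ∈ Carrier ] Maximum _≤_ ⊤ ×
        (¬ IsVariable t → ∃[ t′ ] expr ⊤ ≡ singleLet t t′))
lemma2 S t =
    finite
  , (_ , _ , isDistributiveLattice)
  , (bottom t , bottom-⊑ , refl)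
  , (toMultipattern (top t) , maximum , toLet-top t)
  where open Labellings S
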